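{- For every nested sequent $\Gamma$, $\Gamma$ is derivable in $\mathbf{SS5}$ if and only if $\Gamma$ is derivable in $\mathbf{DS5}$.
   Context: Formulae are in negation normal form over $a,\neg a,\lor,\land,\square,\blacksquare,\lozenge,\lozenge^{\bullet}$ ($\lozenge^{\bullet}$ the past diamond, dual of $\blacksquare$). Nested sequents are multisets of formulae and structures $\circ\{\Gamma\}$, $\bullet\{\Delta\}$; $\Sigma[\,]$ is a context with a hole at any depth. $\mathbf{SKt}$: $id$ ($\Gamma,a,\overline a$), $cut$, $\land$, $\lor$, $ctr$, $wk$, $rf$ (from $\Gamma,\circ\{\Delta\}$ infer $\bullet\{\Gamma\},\Delta$), $rp$ (from $\Gamma,\bullet\{\Delta\}$ infer $\circ\{\Gamma\},\Delta$), $\blacksquare$ (from $\Gamma,\bullet\{A\}$ infer $\Gamma,\blacksquare A$), $\square$ (from $\Gamma,\circ\{A\}$ infer $\Gamma,\square A$), $\lozenge^{\bullet}$ (from $\Gamma,\bullet\{\Delta,A\}$ infer $\Gamma,\bullet\{\Delta\},\lozenge^{\bullet}A$), $\lozenge$ (from $\Gamma,\circ\{\Delta,A\}$ infer $\Gamma,\circ\{\Delta\},\lozenge A$). $\mathbf{SS5}$ is $\mathbf{SKt}$ plus $T_f$ (from $\Gamma,\circ\{\Delta\}$ infer $\Gamma,\Delta$), $4_f$ (from $\Gamma,\circ\{\Delta\}$ infer $\Gamma,\circ\{\circ\{\Delta\}\}$) and $B$ (from $\Gamma,\bullet\{\Delta\}$ infer $\Gamma,\circ\{\Delta\}$). $\mathbf{DKt}$: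 $id$: $\Sigma[a,\overline a]$; $\land$; $\lor$; $\blacksquare$: from $\Sigma[\blacksquare A,\bullet\{A\}]$ infer $\Sigma[\blacksquare A]$; $\square$: from $\Sigma[\square A,\circ\{A\}]$ infer $\Sigma[\square A]$; $\lozenge^{\bullet}_1$: from $\Sigma[\bullet\{\Delta,A\},\lozenge^{\bullet}A]$ infer $\Sigma[\bullet\{\Delta\},\lozenge^{\bullet}A]$; $\lozenge^{\bullet}_2$: from $\Sigma[\circ\{\Delta,\lozenge^{\bullet}A\},A]$ infer $\Sigma[\circ\{\Delta,\lozenge^{\bullet}A\}]$; $\lozenge_1$: from $\Sigma[\circ\{\Delta,A\},\lozenge A]$ infer $\Sigma[\circ\{\Delta\},\lozenge A]$; $\lozenge_2$: from $\Sigma[\bullet\{\Delta,\lozenge A\},A]$ infer $\Sigma[\bullet\{\Delta,\lozenge A\}]$ (where $\land,\lor$ keep the principal formula: from $\Sigma[A\land B,A]$, $\Sigma[A\land B,B]$ infer $\Sigma[A\land B]$; from $\Sigma[A\lor B,A,B]$ infer $\Sigma[A\lor B]$). $\mathbf{DS5}$ is $\mathbf{DKt}$ plus: $T_a$: from $\Sigma[\lozenge^{\bullet}A,A]$ infer $\Sigma[\lozenge^{\bullet}A]$; $T_b$: from $\Sigma[\lozenge A,A]$ infer $\Sigma[\lozenge A]$; $4_a$: from $\Sigma[\lozenge^{\bullet}A,\bullet\{\lozenge^{\bullet}A,\Delta\}]$ infer $\Sigma[\lozenge^{\bullet}A,\bullet\{\Delta\}]$; $4_b$: from $\Sigma[\circ\{\Delta,\lozenge^{\bullet}A\},\lozenge^{\bullet}A]$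 infer $\Sigma[\circ\{\Delta,\lozenge^{\bullet}A\}]$; $4_c$: from $\Sigma[\lozenge A,\circ\{\lozenge A,\Delta\}]$ infer $\Sigma[\lozenge A,\circ\{\Delta\}]$; $4_d$: from $\Sigma[\bullet\{\Delta,\lozenge A\},\lozenge A]$ infer $\Sigma[\bullet\{\Delta,\lozenge A\}]$; $5_a$: from $\Sigma[\lozenge^{\bullet}A,\circ\{\lozenge^{\bullet}A,\Delta\}]$ infer $\Sigma[\lozenge^{\bullet}A,\circ\{\Delta\}]$; $5_b$: from $\Sigma[\circ\{\Delta,\lozenge A\},\lozenge A]$ infer $\Sigma[\circ\{\Delta,\lozenge A\}]$; $5_c$: from $\Sigma[\lozenge A,\bullet\{\lozenge A,\Delta\}]$ infer $\Sigma[\lozenge A,\bullet\{\Delta\}]$; $5_d$: from $\Sigma[\bullet\{\Delta,\lozenge^{\bullet}A\},\lozenge^{\bullet}A]$ infer $\Sigma[\bullet\{\Delta,\lozenge^{\bullet}A\}]$. -}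

module Defs where

open import Data.Nat using (ℕ)
open import Data.List using (List; []; _∷_; _++_; [_])

-- Formulae in negation normal form; atoms are indexed by ℕ.
-- at a = a, na a = ā, □ = box, ■ = past box, ◇ = diamond, ◆ = past diamond.
data Fm : Set where
  at na : ℕ → Fm
  _∨_ _∧_ : Fm → Fm → Fm
  □ ■ ◇ ◆ : Fm → Fm

neg : Fm → Fm
neg (at a) = na a
neg (na a) = at a
neg (A ∨ B) = neg A ∧ neg B
neg (A ∧ B) = neg A ∨ neg B
neg (□ A) = ◇ (neg A)
neg (■ A) = ◆ (neg A)
neg (◇ A) = □ (neg A)
neg (◆ A) = ■ (neg A)

-- Nested sequents: a sequent is a (multi)set of items; an item is a formula,
-- a white structure ∘{Δ} (wh) or a black structure •{Δ} (bl).
data Item : Set where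
  fm : Fm → Item
  wh : List Item → Item
  bl : List Item → Item

Seq : Set
Seq = List Item

mutual
  data _≃_ : Seq → Seq → Set where
    []    : [] ≃ []
    _∷_   : ∀ {x y xs ys} → x ≅ y → xs ≃ ys → (x ∷ xs) ≃ (y ∷ ys)
    swap  : ∀ x y xs → (x ∷ y ∷ xs) ≃ (y ∷ x ∷ xs)
    trans : ∀ {xs ys zs} → xs ≃ ys → ys ≃ zs → xs ≃ zs

  data _≅_ : Item → Item → Set where
    fm : ∀ A → fm A ≅ fm A
    wh : ∀ {Γ Δ} → Γ ≃ Δ → wh Γ ≅ wh Δ
    bl : ∀ {Γ Δ} → Γ ≃ Δ → bl Γ ≅ bl Δ

data Ctx : Set where
  hole : Seq → Ctx
  inWh : Seq → Ctx → Ctx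
  inBl : Seq → Ctx → Ctx

_⟦_⟧ : Ctx → Seq → Seq
hole Γ   ⟦ Δ ⟧ = Γ ++ Δ
inWh Γ Σ ⟦ Δ ⟧ = Γ ++ [ wh (Σ ⟦ Δ ⟧) ]
inBl Γ Σ ⟦ Δ ⟧ = Γ ++ [ bl (Σ ⟦ Δ ⟧) ]

-- Shallow system SS5 = SKt + T_f + 4_f + B (sequents taken up to ≃).
data SS5 : Seq → Set where
  mset : ∀ {Γ Δ} → Γ ≃ Δ → SS5 Γ → SS5 Δ
  id   : ∀ Γ a → SS5 (Γ ++ fm (at a) ∷ fm (na a) ∷ [])
  cut  : ∀ Γ A → SS5 (Γ ++ [ fm A ]) → SS5 (Γ ++ [ fm (neg A) ]) → SS5 Γ
  ∧r   : ∀ Γ A B → SS5 (Γ ++ [ fm A ]) → SS5 (Γ ++ [ fm B ]) → SS5 (Γ ++ [ fm (A ∧ B) ])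
  ∨r   : ∀ Γ A B → SS5 (Γ ++ fm A ∷ fm B ∷ []) → SS5 (Γ ++ [ fm (A ∨ B) ])
  ctr  : ∀ Γ Δ → SS5 (Γ ++ Δ ++ Δ) → SS5 (Γ ++ Δ)
  wk   : ∀ Γ Δ → SS5 Γ → SS5 (Γ ++ Δ)
  rf   : ∀ Γ Δ → SS5 (Γ ++ [ wh Δ ]) → SS5 (bl Γ ∷ Δ)
  rp   : ∀ Γ Δ → SS5 (Γ ++ [ bl Δ ]) → SS5 (wh Γ ∷ Δ)
  ■r   : ∀ Γ A → SS5 (Γ ++ [ bl [ fm A ] ]) → SS5 (Γ ++ [ fm (■ A) ])
  □r   : ∀ Γ A → SS5 (Γ ++ [ wh [ fm A ] ]) → SS5 (Γ ++ [ fm (□ A) ])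
  ◆r   : ∀ Γ Δ A → SS5 (Γ ++ [ bl (Δ ++ [ fm A ]) ]) → SS5 (Γ ++ bl Δ ∷ fm (◆ A) ∷ [])
  ◇r   : ∀ Γ Δ A → SS5 (Γ ++ [ wh (Δ ++ [ fm A ]) ]) → SS5 (Γ ++ wh Δ ∷ fm (◇ A) ∷ [])
  Tf   : ∀ Γ Δ → SS5 (Γ ++ [ wh Δ ]) → SS5 (Γ ++ Δ)
  4f   : ∀ Γ Δ → SS5 (Γ ++ [ wh Δ ]) → SS5 (Γ ++ [ wh [ wh Δ ] ])
  B    : ∀ Γ Δ → SS5 (Γ ++ [ bl Δ ]) → SS5 (Γ ++ [ wh Δ ])

-- Deep system DS5 = DKt + T_a,T_b,4_a..4_d,5_a..5_d (sequents taken up to ≃).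
data DS5 : Seq → Set where
  mset : ∀ {Γ Δ} → Γ ≃ Δ → DS5 Γ → DS5 Δ
  id   : ∀ Σ a → DS5 (Σ ⟦ fm (at a) ∷ fm (na a) ∷ [] ⟧)
  ∧r   : ∀ Σ A B → DS5 (Σ ⟦ fm (A ∧ B) ∷ fm A ∷ [] ⟧) → DS5 (Σ ⟦ fm (A ∧ B) ∷ fm B ∷ [] ⟧)
         → DS5 (Σ ⟦ fm (A ∧ B) ∷ [] ⟧)
  ∨r   : ∀ Σ A B → DS5 (Σ ⟦ fm (A ∨ B) ∷ fm A ∷ fm B ∷ [] ⟧) → DS5 (Σ ⟦ fm (A ∨ B) ∷ [] ⟧)
  ■r   : ∀ Σ A → DS5 (Σ ⟦ fm (■ A) ∷ bl (fm A ∷ []) ∷ [] ⟧) → DS5 (Σ ⟦ fm (■ A) ∷ [] ⟧)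
  □r   : ∀ Σ A → DS5 (Σ ⟦ fm (□ A) ∷ wh (fm A ∷ []) ∷ [] ⟧) → DS5 (Σ ⟦ fm (□ A) ∷ [] ⟧)
  ◆₁   : ∀ Σ Δ A → DS5 (Σ ⟦ bl (Δ ++ fm A ∷ []) ∷ fm (◆ A) ∷ [] ⟧) → DS5 (Σ ⟦ bl Δ ∷ fm (◆ A) ∷ [] ⟧)
  ◆₂   : ∀ Σ Δ A → DS5 (Σ ⟦ wh (Δ ++ fm (◆ A) ∷ []) ∷ fm A ∷ [] ⟧) → DS5 (Σ ⟦ wh (Δ ++ fm (◆ A) ∷ []) ∷ [] ⟧)
  ◇₁   : ∀ Σ Δ A → DS5 (Σ ⟦ wh (Δ ++ fm A ∷ []) ∷ fm (◇ A) ∷ [] ⟧) → DS5 (Σ ⟦ wh Δ ∷ fm (◇ A) ∷ [] ⟧)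
  ◇₂   : ∀ Σ Δ A → DS5 (Σ ⟦ bl (Δ ++ fm (◇ A) ∷ []) ∷ fm A ∷ [] ⟧) → DS5 (Σ ⟦ bl (Δ ++ fm (◇ A) ∷ []) ∷ [] ⟧)
  Ta   : ∀ Σ A → DS5 (Σ ⟦ fm (◆ A) ∷ fm A ∷ [] ⟧) → DS5 (Σ ⟦ fm (◆ A) ∷ [] ⟧)
  Tb   : ∀ Σ A → DS5 (Σ ⟦ fm (◇ A) ∷ fm A ∷ [] ⟧) → DS5 (Σ ⟦ fm (◇ A) ∷ [] ⟧)
  4a   : ∀ Σ Δ A → DS5 (Σ ⟦ fm (◆ A) ∷ bl (fm (◆ A) ∷ Δ) ∷ [] ⟧) → DS5 (Σ ⟦ fm (◆ A) ∷ bl Δ ∷ [] ⟧)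
  4b   : ∀ Σ Δ A → DS5 (Σ ⟦ wh (Δ ++ fm (◆ A) ∷ []) ∷ fm (◆ A) ∷ [] ⟧) → DS5 (Σ ⟦ wh (Δ ++ fm (◆ A) ∷ []) ∷ [] ⟧)
  4c   : ∀ Σ Δ A → DS5 (Σ ⟦ fm (◇ A) ∷ wh (fm (◇ A) ∷ Δ) ∷ [] ⟧) → DS5 (Σ ⟦ fm (◇ A) ∷ wh Δ ∷ [] ⟧)
  4d   : ∀ Σ Δ A → DS5 (Σ ⟦ bl (Δ ++ fm (◇ A) ∷ []) ∷ fm (◇ A) ∷ [] ⟧) → DS5 (Σ ⟦ bl (Δ ++ fm (◇ A) ∷ []) ∷ [] ⟧)
  5a   : ∀ Σ Δ A → DS5 (Σ ⟦ fm (◆ A) ∷ wh (fm (◆ A) ∷ Δ) ∷ [] ⟧) → DS5 (Σ ⟦ fm (◆ A) ∷ wh Δ ∷ [] ⟧)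
  5b   : ∀ Σ Δ A → DS5 (Σ ⟦ wh (Δ ++ fm (◇ A) ∷ []) ∷ fm (◇ A) ∷ [] ⟧) → DS5 (Σ ⟦ wh (Δ ++ fm (◇ A) ∷ []) ∷ [] ⟧)
  5c   : ∀ Σ Δ A → DS5 (Σ ⟦ fm (◇ A) ∷ bl (fm (◇ A) ∷ Δ) ∷ [] ⟧) → DS5 (Σ ⟦ fm (◇ A) ∷ bl Δ ∷ [] ⟧)
  5d   : ∀ Σ Δ A → DS5 (Σ ⟦ bl (Δ ++ fm (◆ A) ∷ []) ∷ fm (◆ A) ∷ [] ⟧) → DS5 (Σ ⟦ bl (Δ ++ fm (◆ A) ∷ []) ∷ [] ⟧)

{-# OPTIONS --safe #-}
-- In Kripke models with a universal accessibility relation the two diamonds agree, as do the two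
-- kinds of structure, and both systems are sound and complete for such models.
-- From DS5 to SS5, the hole of a context is displayed at the root by rf and rp, and a diamond is
-- moved to another node by a cut against ◇A, ∘{¬◇A}, which 4f provides.
-- From SS5 to DS5, SS5 with cut is sound for finite models, while a DS5 proof search on finite sets
-- of labelled formulae either succeeds or saturates to a finite countermodel. In DS5 a diamond can
-- be copied to every node of the tree, so the search may ignore the shape of the tree.

module Submission where

open import Defs
open import Algebra.Bundles using (CommutativeMonoid)
import Algebra.Solver.CommutativeMonoid as CommutativeMonoidSolver
open import Data.Bool using (Bool; true; false; if_then_else_)
open import Data.Empty using (⊥; ⊥-elim)
open import Data.List using (List; []; _∷_; _++_; [_]; length; map; cartesianProduct)
open import Data.List.Properties using (++-assoc; ++-identityʳ)
import Data.List.Membership.DecPropositional as DecMembership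
open import Data.List.Membership.Propositional using (_∈_; _∉_)
open import Data.List.Membership.Propositional.Properties
  using (∈-++⁺ˡ; ∈-++⁺ʳ; ∈-++⁻; ∈-map⁺; ∈-map⁻; ∈-cartesianProduct⁺)
open import Data.List.Relation.Binary.Subset.Propositional using (_⊆_)
open import Data.List.Relation.Unary.Any using (here; there)
import Data.Maybe as Maybe
open import Data.Maybe using (Maybe; just; nothing)
open import Data.Maybe.Relation.Unary.All using (just; nothing) renaming (All to AllM)
open import Data.Nat using (ℕ; zero; suc)
import Data.Nat.Properties as ℕ
open import Data.Product using (_×_; _,_; proj₁; proj₂; ∃-syntax)
import Data.Product.Properties as Product
open import Data.Sum using (_⊎_; inj₁; inj₂; map₁; map₂)
  renaming (map to ⊎-map; swap to ⊎-swap)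
open import Data.Unit using (⊤; tt)
open import Function using (_∘_)
open import Relation.Binary.Definitions using (DecidableEquality)
open import Relation.Binary.PropositionalEquality
  using (_≡_; refl; cong; subst) renaming (sym to ≡-sym; trans to ≡-trans)
open import Relation.Nullary using (Dec; ¬_; yes; no; does; contradiction)
open import Relation.Nullary.Decidable using (map′; _×-dec_; dec-true; dec-false)

-- Sequents up to permutation

-- Simulating SS5 rule by rule would require eliminating cut from DS5, which has neither contraction
-- nor weakening as a rule; hence the detour through models. To stay constructive, the models must
-- be finite, so that failure of a formula is decidable and cut is sound without classical logic,
-- and the search must terminate. It does because a world is named by the formula it was created
-- for: accessibility being universal, one world where A fails serves every box over A, wherever
-- that box stands, so labels and formulae both range over the subformulae of a single formula. A
-- further obstacle is that the given sequent is a tree, while the search starts from one fact. The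
-- tree is translated into a formula that its root is deemed to hold, and decomposing that formula
-- only points at items already present. Provability of a set of facts is therefore stated for all
-- sequents whose nodes cover the facts, which makes surplus formulae harmless.

mutual
  ≃-refl : ∀ {Γ} → Γ ≃ Γ
  ≃-refl {[]}    = []
  ≃-refl {x ∷ Γ} = ≅-refl ∷ ≃-refl

  ≅-refl : ∀ {x} → x ≅ x
  ≅-refl {fm A} = fm A
  ≅-refl {wh Δ} = wh ≃-refl
  ≅-refl {bl Δ} = bl ≃-refl

mutual
  ≃-sym : ∀ {Γ Δ} → Γ ≃ Δ → Δ ≃ Γ
  ≃-sym []           = []
  ≃-sym (e ∷ es)     = ≅-sym e ∷ ≃-sym es
  ≃-sym (swap x y Γ) = swap y x Γ
  ≃-sym (trans d e)  = trans (≃-sym e) (≃-sym d)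

  ≅-sym : ∀ {x y} → x ≅ y → y ≅ x
  ≅-sym (fm A) = fm A
  ≅-sym (wh e) = wh (≃-sym e)
  ≅-sym (bl e) = bl (≃-sym e)

≃-reflexive : ∀ {Γ Δ} → Γ ≡ Δ → Γ ≃ Δ
≃-reflexive refl = ≃-refl

++-congˡ : ∀ Γ {Δ Δ′} → Δ ≃ Δ′ → (Γ ++ Δ) ≃ (Γ ++ Δ′)
++-congˡ []      e = e
++-congˡ (x ∷ Γ) e = ≅-refl ∷ ++-congˡ Γ e

++-congʳ : ∀ {Γ Γ′} Δ → Γ ≃ Γ′ → (Γ ++ Δ) ≃ (Γ′ ++ Δ)
++-congʳ Δ []           = ≃-refl
++-congʳ Δ (e ∷ es)     = e ∷ ++-congʳ Δ es
++-congʳ Δ (swap x y Γ) = swap x y (Γ ++ Δ)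
++-congʳ Δ (trans d e)  = trans (++-congʳ Δ d) (++-congʳ Δ e)

shift : ∀ x Γ Δ → (x ∷ Γ ++ Δ) ≃ (Γ ++ x ∷ Δ)
shift x []      Δ = ≃-refl
shift x (y ∷ Γ) Δ = trans (swap x y (Γ ++ Δ)) (≅-refl ∷ shift x Γ Δ)

++-comm : ∀ Γ Δ → (Γ ++ Δ) ≃ (Δ ++ Γ)
++-comm []      Δ = ≃-reflexive (≡-sym (++-identityʳ Δ))
++-comm (x ∷ Γ) Δ = trans (≅-refl ∷ ++-comm Γ Δ) (shift x Δ Γ)

++-commutativeMonoid : CommutativeMonoid _ _
++-commutativeMonoid = record
  { Carrier = Seq ; _≈_ = _≃_ ; _∙_ = _++_ ; ε = []
  ; isCommutativeMonoid = record
    { isMonoid = record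
      { isSemigroup = record
        { isMagma = record
          { isEquivalence = record { refl = ≃-refl ; sym = ≃-sym ; trans = trans }
          ; ∙-cong = λ {Γ} {_} {_} {Δ′} d e → trans (++-congˡ Γ e) (++-congʳ Δ′ d)
          }
        ; assoc = λ Γ Δ Θ → ≃-reflexive (++-assoc Γ Δ Θ)
        }
      ; identity = (λ _ → ≃-refl) , (λ Γ → ≃-reflexive (++-identityʳ Γ))
      }
    ; comm = ++-comm
    }
  }

open CommutativeMonoidSolver ++-commutativeMonoid using (solve; _⊜_; _⊕_)

[wh] : ∀ {Γ Δ} → Γ ≃ Δ → [ wh Γ ] ≃ [ wh Δ ]
[wh] e = wh e ∷ []

[bl] : ∀ {Γ Δ} → Γ ≃ Δ → [ bl Γ ] ≃ [ bl Δ ]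
[bl] e = bl e ∷ []

rotate : ∀ Γ Δ Θ → (Γ ++ Δ ++ Θ) ≃ (Γ ++ Θ ++ Δ)
rotate = solve 3 (λ g d t → g ⊕ (d ⊕ t) ⊜ g ⊕ (t ⊕ d)) ≃-refl

pull : ∀ Γ Δ Θ → (Γ ++ Δ ++ Θ) ≃ ((Γ ++ Θ) ++ Δ)
pull = solve 3 (λ g d t → g ⊕ (d ⊕ t) ⊜ (g ⊕ t) ⊕ d) ≃-refl

push : ∀ Γ Δ Θ → (Γ ++ Δ ++ Θ) ≃ ((Γ ++ Δ) ++ Θ)
push Γ Δ Θ = ≃-reflexive (≡-sym (++-assoc Γ Δ Θ))

-- Deep rules in the shallow system

wk-front : ∀ Γ {Δ} → SS5 Δ → SS5 (Γ ++ Δ)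
wk-front Γ {Δ} d = mset (++-comm Δ Γ) (wk Δ Γ d)

-- With the two sequents exchanged, `rp` undoes `rf` up to permutation, so displaying a node loses
-- nothing.
unrf : ∀ Γ Δ → SS5 (bl Γ ∷ Δ) → SS5 (Γ ++ [ wh Δ ])
unrf Γ Δ d = mset (++-comm [ wh Δ ] Γ) (rp Δ Γ (mset (++-comm [ bl Γ ] Δ) d))

unrp : ∀ Γ Δ → SS5 (wh Γ ∷ Δ) → SS5 (Γ ++ [ bl Δ ])
unrp Γ Δ d = mset (++-comm [ bl Δ ] Γ) (rf Δ Γ (mset (++-comm [ wh Γ ] Δ) d))

-- Converse of `B`: after display the black structure holds Γ instead of Δ, `B` whitens it, and a
-- second `rf` puts Γ back at the root. The two kinds of structure thus become interchangeable.
wh⇒bl : ∀ Γ Δ → SS5 (Γ ++ [ wh Δ ]) → SS5 (Γ ++ [ bl Δ ])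
wh⇒bl Γ Δ d =
  mset (++-comm [ bl Δ ] Γ) (rf Δ Γ (B Δ Γ (mset (++-comm [ bl Γ ] Δ) (rf Γ Δ d))))

ctr₁ : ∀ Γ x → SS5 (Γ ++ x ∷ x ∷ []) → SS5 (Γ ++ [ x ])
ctr₁ Γ x = ctr Γ [ x ]

-- Necessitation: weakening adds an empty black structure, which plays the parent of Δ once `unrf`
-- reverses the edge.
wh-wrap : ∀ {Δ} → SS5 Δ → SS5 [ wh Δ ]
wh-wrap d = unrf [] _ (wk-front [ bl [] ] d)

bl-wrap : ∀ {Δ} → SS5 Δ → SS5 [ bl Δ ]
bl-wrap d = wh⇒bl [] _ (wh-wrap d)

excluded-middle : ∀ A → SS5 (fm A ∷ fm (neg A) ∷ [])
excluded-middle (at a)  = id [] a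
excluded-middle (na a)  = mset (swap _ _ _) (id [] a)
excluded-middle (A ∨ C) = mset (swap _ _ _)
  (∨r [ fm (neg A ∧ neg C) ] A C
    (mset (solve 3 (λ a c n → (a ⊕ c) ⊕ n ⊜ n ⊕ (a ⊕ c)) ≃-refl
             [ fm A ] [ fm C ] [ fm (neg A ∧ neg C) ])
      (∧r (fm A ∷ fm C ∷ []) (neg A) (neg C)
        (mset (≅-refl ∷ swap _ _ _) (wk _ [ fm C ] (excluded-middle A)))
        (wk-front [ fm A ] (excluded-middle C)))))
excluded-middle (A ∧ C) =
  ∨r [ fm (A ∧ C) ] (neg A) (neg C)
    (mset (solve 3 (λ a c n → (a ⊕ c) ⊕ n ⊜ n ⊕ (a ⊕ c)) ≃-refl
             [ fm (neg A) ] [ fm (neg C) ] [ fm (A ∧ C) ])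
      (∧r (fm (neg A) ∷ fm (neg C) ∷ []) A C
        (mset (solve 3 (λ a c n → (a ⊕ c) ⊕ n ⊜ (c ⊕ n) ⊕ a) ≃-refl
               [ fm A ] [ fm (neg A) ] [ fm (neg C) ])
          (wk _ [ fm (neg C) ] (excluded-middle A)))
        (wk-front [ fm (neg A) ] (mset (swap _ _ _) (excluded-middle C)))))
excluded-middle (□ A) = mset (swap _ _ _)
  (□r [ fm (◇ (neg A)) ] A
    (mset (swap _ _ _) (◇r [] [ fm A ] (neg A) (wh-wrap (excluded-middle A)))))
excluded-middle (■ A) = mset (swap _ _ _)
  (■r [ fm (◆ (neg A)) ] A
    (mset (swap _ _ _) (◆r [] [ fm A ] (neg A) (bl-wrap (excluded-middle A)))))
excluded-middle (◇ A) =
  □r [ fm (◇ A) ] (neg A)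
    (mset (swap _ _ _)
      (◇r [] [ fm (neg A) ] A (wh-wrap (mset (swap _ _ _) (excluded-middle A)))))
excluded-middle (◆ A) =
  ■r [ fm (◆ A) ] (neg A)
    (mset (swap _ _ _)
      (◆r [] [ fm (neg A) ] A (bl-wrap (mset (swap _ _ _) (excluded-middle A)))))

-- Cut acts only at the root, so the inner node is displayed there; weakening first gives both
-- premises the same surroundings Γ and Θ.
cut-wh : ∀ Γ Θ Δ A → SS5 (Θ ++ [ wh [ fm (neg A) ] ]) →
         SS5 (Γ ++ [ wh (Δ ++ [ fm A ]) ]) → SS5 ((Γ ++ Θ) ++ [ wh Δ ])
cut-wh Γ Θ Δ A d e = unrf (Γ ++ Θ) Δ (cut (bl (Γ ++ Θ) ∷ Δ) A
  (rf (Γ ++ Θ) (Δ ++ [ fm A ]) (mset (pull Γ _ Θ) (mset (≃-sym (push Γ _ Θ)) (wk _ Θ e))))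
  (mset (≅-refl ∷ ++-comm [ fm (neg A) ] Δ)
    (wk (bl (Γ ++ Θ) ∷ [ fm (neg A) ]) Δ
      (rf (Γ ++ Θ) [ fm (neg A) ] (mset (push Γ Θ _) (wk-front Γ d))))))

cut-bl : ∀ Γ Θ Δ A → SS5 (Θ ++ [ bl [ fm (neg A) ] ]) →
         SS5 (Γ ++ [ bl (Δ ++ [ fm A ]) ]) → SS5 ((Γ ++ Θ) ++ [ bl Δ ])
cut-bl Γ Θ Δ A d e =
  wh⇒bl (Γ ++ Θ) Δ (cut-wh Γ Θ Δ A (B Θ _ d) (B Γ _ e))

-- This is axiom 4 for `neg A`, from □ to □□: `4f` doubles the structure around `neg A`, and the
-- inner layer is then displayed and turned into a box.
cut-◇ : ∀ A → SS5 (fm (◇ A) ∷ [ wh [ fm (neg (◇ A)) ] ])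
cut-◇ A = unrf [ fm (◇ A) ] _ (□r [ bl [ fm (◇ A) ] ] (neg A)
  (rf [ fm (◇ A) ] _ (4f [ fm (◇ A) ] [ fm (neg A) ]
    (mset (swap _ _ _)
      (◇r [] [ fm (neg A) ] A (wh-wrap (mset (swap _ _ _) (excluded-middle A))))))))

cut-◆ : ∀ A → SS5 (fm (◆ A) ∷ [ wh [ fm (neg (◆ A)) ] ])
cut-◆ A = unrf [ fm (◆ A) ] _ (■r [ bl [ fm (◆ A) ] ] (neg A)
  -- `4f` speaks of white structures only: `B` whitens the black one before it, and `wh⇒bl` blackens
  -- the inner layer again for `■r`.
  (wh⇒bl [ bl [ fm (◆ A) ] ] _ (rf [ fm (◆ A) ] _ (4f [ fm (◆ A) ] [ fm (neg A) ]
    (B [ fm (◆ A) ] _ (mset (swap _ _ _)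
      (◆r [] [ fm (neg A) ] A (bl-wrap (mset (swap _ _ _) (excluded-middle A))))))))))

-- The cut premise `out` alone yields all the copying rules: `4c`, `4d`, `5b`, `5c` for ◇, and `4a`,
-- `4b`, `5a`, `5d` for ◆.
module Transitive (D : Fm → Fm)
  (out : ∀ A → SS5 (fm (D A) ∷ [ wh [ fm (neg (D A)) ] ])) where

  pull-wh : ∀ Γ Δ A → SS5 (Γ ++ [ wh (Δ ++ [ fm (D A) ]) ]) → SS5 ((Γ ++ [ fm (D A) ]) ++ [ wh Δ ])
  pull-wh Γ Δ A = cut-wh Γ [ fm (D A) ] Δ (D A) (out A)

  pull-bl : ∀ Γ Δ A → SS5 (Γ ++ [ bl (Δ ++ [ fm (D A) ]) ]) → SS5 ((Γ ++ [ fm (D A) ]) ++ [ bl Δ ])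
  pull-bl Γ Δ A = cut-bl Γ [ fm (D A) ] Δ (D A) (wh⇒bl [ fm (D A) ] _ (out A))

  private
    contract : ∀ Γ x y → SS5 (((Γ ++ [ x ]) ++ [ x ]) ++ [ y ]) → SS5 (Γ ++ x ∷ y ∷ [])
    contract Γ x y d = mset (rotate Γ [ y ] [ x ])
      (mset (≃-sym (push Γ [ y ] [ x ])) (ctr₁ (Γ ++ [ y ]) x
        (mset (solve 3 (λ g a c → ((g ⊕ a) ⊕ a) ⊕ c ⊜ (g ⊕ c) ⊕ (a ⊕ a)) ≃-refl Γ [ x ] [ y ]) d)))

  wh-down : ∀ Δ A Γ → SS5 (Γ ++ fm (D A) ∷ wh (fm (D A) ∷ Δ) ∷ []) → SS5 (Γ ++ fm (D A) ∷ wh Δ ∷ [])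
  wh-down Δ A Γ d = contract Γ _ _ (pull-wh (Γ ++ [ fm (D A) ]) Δ A
    (mset (trans (push Γ [ fm (D A) ] _)
      (++-congˡ (Γ ++ [ fm (D A) ]) ([wh] (++-comm [ fm (D A) ] Δ)))) d))

  bl-down : ∀ Δ A Γ → SS5 (Γ ++ fm (D A) ∷ bl (fm (D A) ∷ Δ) ∷ []) → SS5 (Γ ++ fm (D A) ∷ bl Δ ∷ [])
  bl-down Δ A Γ d = contract Γ _ _ (pull-bl (Γ ++ [ fm (D A) ]) Δ A
    (mset (trans (push Γ [ fm (D A) ] _)
      (++-congˡ (Γ ++ [ fm (D A) ]) ([bl] (++-comm [ fm (D A) ] Δ)))) d))

  private
    contract′ : ∀ Δ x y → SS5 (((Δ ++ [ x ]) ++ [ x ]) ++ [ y ]) → SS5 (y ∷ Δ ++ [ x ])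
    contract′ Δ x y d = ctr₁ (y ∷ Δ) x
      (mset (solve 3 (λ g a c → ((g ⊕ a) ⊕ a) ⊕ c ⊜ (c ⊕ g) ⊕ (a ⊕ a)) ≃-refl Δ [ x ] [ y ]) d)

  -- Display reverses the edge: the parent becomes a black substructure, `pull-bl` cuts the diamond
  -- out of it, and contraction merges it with the copy already beside Δ.
  wh-up : ∀ Δ A Γ → SS5 (Γ ++ wh (Δ ++ [ fm (D A) ]) ∷ fm (D A) ∷ []) →
          SS5 (Γ ++ [ wh (Δ ++ [ fm (D A) ]) ])
  wh-up Δ A Γ d = unrf Γ (Δ ++ [ fm (D A) ]) (contract′ Δ _ _
    (pull-bl (Δ ++ [ fm (D A) ]) Γ A
      (mset (++-comm [ bl (Γ ++ [ fm (D A) ]) ] (Δ ++ [ fm (D A) ]))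
        (rf (Γ ++ [ fm (D A) ]) (Δ ++ [ fm (D A) ]) (mset (pull Γ [ _ ] [ _ ]) d)))))

  bl-up : ∀ Δ A Γ → SS5 (Γ ++ bl (Δ ++ [ fm (D A) ]) ∷ fm (D A) ∷ []) →
          SS5 (Γ ++ [ bl (Δ ++ [ fm (D A) ]) ])
  bl-up Δ A Γ d = unrp Γ (Δ ++ [ fm (D A) ]) (contract′ Δ _ _
    (pull-wh (Δ ++ [ fm (D A) ]) Γ A
      (mset (++-comm [ wh (Γ ++ [ fm (D A) ]) ] (Δ ++ [ fm (D A) ]))
        (rp (Γ ++ [ fm (D A) ]) (Δ ++ [ fm (D A) ]) (mset (pull Γ [ _ ] [ _ ]) d)))))

module T◇ = Transitive ◇ cut-◇
module T◆ = Transitive ◆ cut-◆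

-- Descending one layer packs everything outside it into a single structure, which becomes the new
-- Γ; this is why the rule `r` must hold for every Γ. The index type is empty for axioms and has one
-- or two elements for the other rules.
in-context : ∀ {I : Set} Δ (Δs : I → Seq) →
  (∀ Γ → (∀ i → SS5 (Γ ++ Δs i)) → SS5 (Γ ++ Δ)) →
  ∀ Σ Γ → (∀ i → SS5 (Γ ++ Σ ⟦ Δs i ⟧)) → SS5 (Γ ++ Σ ⟦ Δ ⟧)
in-context Δ Δs r (hole Θ) Γ ds =
  mset (≃-sym (push Γ Θ Δ)) (r (Γ ++ Θ) (λ i → mset (push Γ Θ (Δs i)) (ds i)))
in-context Δ Δs r (inWh Θ Σ) Γ ds = mset (≃-sym (push Γ Θ _)) (unrf (Γ ++ Θ) _
  (in-context Δ Δs r Σ [ bl (Γ ++ Θ) ] (λ i → rf (Γ ++ Θ) _ (mset (push Γ Θ _) (ds i)))))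
in-context Δ Δs r (inBl Θ Σ) Γ ds = mset (≃-sym (push Γ Θ _)) (unrp (Γ ++ Θ) _
  (in-context Δ Δs r Σ [ wh (Γ ++ Θ) ] (λ i → rp (Γ ++ Θ) _ (mset (push Γ Θ _) (ds i)))))

in-context₁ : ∀ {Δ Δ′} → (∀ Γ → SS5 (Γ ++ Δ′) → SS5 (Γ ++ Δ)) → ∀ Σ → SS5 (Σ ⟦ Δ′ ⟧) → SS5 (Σ ⟦ Δ ⟧)
in-context₁ {Δ} {Δ′} r Σ d = in-context {⊤} Δ (λ _ → Δ′) (λ Γ ds → r Γ (ds tt)) Σ [] (λ _ → d)

-- Shallow rules consume their principal formula and deep ones keep it; contraction makes up the
-- difference.
absorb : ∀ x (Δ : Seq) → (∀ Γ → SS5 (Γ ++ Δ) → SS5 (Γ ++ [ x ])) →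
         ∀ Γ → SS5 (Γ ++ x ∷ Δ) → SS5 (Γ ++ [ x ])
absorb x Δ r Γ d =
  ctr₁ Γ x (mset (≃-sym (push Γ [ x ] [ x ])) (r (Γ ++ [ x ]) (mset (push Γ [ x ] Δ) d)))

◆-down : ∀ Δ A Γ → SS5 (Γ ++ bl (Δ ++ [ fm A ]) ∷ fm (◆ A) ∷ []) → SS5 (Γ ++ bl Δ ∷ fm (◆ A) ∷ [])
◆-down Δ A Γ d = mset (≃-sym (push Γ _ _)) (ctr₁ (Γ ++ [ bl Δ ]) (fm (◆ A))
  (mset (solve 3 (λ g c a → (g ⊕ a) ⊕ (c ⊕ a) ⊜ (g ⊕ c) ⊕ (a ⊕ a)) ≃-refl Γ [ bl Δ ] [ fm (◆ A) ])
    (◆r (Γ ++ [ fm (◆ A) ]) Δ A (mset (pull Γ _ _) d))))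

◇-down : ∀ Δ A Γ → SS5 (Γ ++ wh (Δ ++ [ fm A ]) ∷ fm (◇ A) ∷ []) → SS5 (Γ ++ wh Δ ∷ fm (◇ A) ∷ [])
◇-down Δ A Γ d = mset (≃-sym (push Γ _ _)) (ctr₁ (Γ ++ [ wh Δ ]) (fm (◇ A))
  (mset (solve 3 (λ g c a → (g ⊕ a) ⊕ (c ⊕ a) ⊜ (g ⊕ c) ⊕ (a ⊕ a)) ≃-refl Γ [ wh Δ ] [ fm (◇ A) ])
    (◇r (Γ ++ [ fm (◇ A) ]) Δ A (mset (pull Γ _ _) d))))

◆-up : ∀ Δ A Γ → SS5 (Γ ++ wh (Δ ++ [ fm (◆ A) ]) ∷ fm A ∷ []) →
       SS5 (Γ ++ [ wh (Δ ++ [ fm (◆ A) ]) ])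
◆-up Δ A Γ d = unrf Γ _ (mset (++-comm (Δ ++ [ fm (◆ A) ]) [ bl Γ ])
  (mset (pull Δ [ bl Γ ] _) (◆-down Γ A Δ
  (mset (≃-sym (pull Δ _ _)) (mset (++-comm [ bl (Γ ++ [ fm A ]) ] (Δ ++ [ fm (◆ A) ]))
    (rf (Γ ++ [ fm A ]) (Δ ++ [ fm (◆ A) ]) (mset (pull Γ _ _) d)))))))

◇-up : ∀ Δ A Γ → SS5 (Γ ++ bl (Δ ++ [ fm (◇ A) ]) ∷ fm A ∷ []) →
       SS5 (Γ ++ [ bl (Δ ++ [ fm (◇ A) ]) ])
◇-up Δ A Γ d = unrp Γ _ (mset (++-comm (Δ ++ [ fm (◇ A) ]) [ wh Γ ])
  (mset (pull Δ [ wh Γ ] _) (◇-down Γ A Δ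
  (mset (≃-sym (pull Δ _ _)) (mset (++-comm [ wh (Γ ++ [ fm A ]) ] (Δ ++ [ fm (◇ A) ]))
    (rp (Γ ++ [ fm A ]) (Δ ++ [ fm (◇ A) ]) (mset (pull Γ _ _) d)))))))

-- The whole sequent is wrapped in a structure so that `◆r` can take A out of it; `B` and `Tf` then
-- dissolve the wrapping.
◆-T : ∀ A Γ → SS5 (Γ ++ [ fm A ]) → SS5 (Γ ++ [ fm (◆ A) ])
◆-T A Γ d = mset (++-comm [ fm (◆ A) ] Γ) (Tf [ fm (◆ A) ] Γ (B [ fm (◆ A) ] Γ
  (mset (swap _ _ _) (◆r [] Γ A (bl-wrap d)))))

◇-T : ∀ A Γ → SS5 (Γ ++ [ fm A ]) → SS5 (Γ ++ [ fm (◇ A) ])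
◇-T A Γ d = mset (++-comm [ fm (◇ A) ] Γ) (Tf [ fm (◇ A) ] Γ
  (mset (swap _ _ _) (◇r [] Γ A (wh-wrap d))))

DS5⇒SS5 : ∀ {Γ} → DS5 Γ → SS5 Γ
DS5⇒SS5 (mset e d)   = mset e (DS5⇒SS5 d)
DS5⇒SS5 (id Σ a)     = in-context {⊥} _ ⊥-elim (λ Γ _ → id Γ a) Σ [] (λ ())
DS5⇒SS5 (∧r Σ A C d e) = in-context {Bool} _
  (λ { true → fm (A ∧ C) ∷ fm A ∷ [] ; false → fm (A ∧ C) ∷ fm C ∷ [] })
  (λ Γ ds → ctr₁ Γ _ (mset (≃-sym (push Γ _ _)) (∧r (Γ ++ [ fm (A ∧ C) ]) A C
    (mset (push Γ _ _) (ds true)) (mset (push Γ _ _) (ds false)))))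
  Σ [] (λ { true → DS5⇒SS5 d ; false → DS5⇒SS5 e })
DS5⇒SS5 (∨r Σ A C d) = in-context₁ (absorb _ _ (λ Γ → ∨r Γ A C)) Σ (DS5⇒SS5 d)
DS5⇒SS5 (■r Σ A d)   = in-context₁ (absorb _ _ (λ Γ → ■r Γ A)) Σ (DS5⇒SS5 d)
DS5⇒SS5 (□r Σ A d)   = in-context₁ (absorb _ _ (λ Γ → □r Γ A)) Σ (DS5⇒SS5 d)
DS5⇒SS5 (◆₁ Σ Δ A d) = in-context₁ (◆-down Δ A) Σ (DS5⇒SS5 d)
DS5⇒SS5 (◆₂ Σ Δ A d) = in-context₁ (◆-up Δ A) Σ (DS5⇒SS5 d)
DS5⇒SS5 (◇₁ Σ Δ A d) = in-context₁ (◇-down Δ A) Σ (DS5⇒SS5 d)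
DS5⇒SS5 (◇₂ Σ Δ A d) = in-context₁ (◇-up Δ A) Σ (DS5⇒SS5 d)
DS5⇒SS5 (Ta Σ A d)   = in-context₁ (absorb _ _ (◆-T A)) Σ (DS5⇒SS5 d)
DS5⇒SS5 (Tb Σ A d)   = in-context₁ (absorb _ _ (◇-T A)) Σ (DS5⇒SS5 d)
DS5⇒SS5 (4a Σ Δ A d) = in-context₁ (T◆.bl-down Δ A) Σ (DS5⇒SS5 d)
DS5⇒SS5 (4b Σ Δ A d) = in-context₁ (T◆.wh-up Δ A) Σ (DS5⇒SS5 d)
DS5⇒SS5 (4c Σ Δ A d) = in-context₁ (T◇.wh-down Δ A) Σ (DS5⇒SS5 d)
DS5⇒SS5 (4d Σ Δ A d) = in-context₁ (T◇.bl-up Δ A) Σ (DS5⇒SS5 d)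
DS5⇒SS5 (5a Σ Δ A d) = in-context₁ (T◆.wh-down Δ A) Σ (DS5⇒SS5 d)
DS5⇒SS5 (5b Σ Δ A d) = in-context₁ (T◇.wh-up Δ A) Σ (DS5⇒SS5 d)
DS5⇒SS5 (5c Σ Δ A d) = in-context₁ (T◇.bl-down Δ A) Σ (DS5⇒SS5 d)
DS5⇒SS5 (5d Σ Δ A d) = in-context₁ (T◆.bl-up Δ A) Σ (DS5⇒SS5 d)

-- Positions in a nested sequent

⟦⟧-cong : ∀ Σ {Γ Δ} → Γ ≃ Δ → (Σ ⟦ Γ ⟧) ≃ (Σ ⟦ Δ ⟧)
⟦⟧-cong (hole Θ)   e = ++-congˡ Θ e
⟦⟧-cong (inWh Θ Σ) e = ++-congˡ Θ ([wh] (⟦⟧-cong Σ e))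
⟦⟧-cong (inBl Θ Σ) e = ++-congˡ Θ ([bl] (⟦⟧-cong Σ e))

_∘ᶜ_ : Ctx → Ctx → Ctx
hole Γ   ∘ᶜ hole Δ   = hole (Γ ++ Δ)
hole Γ   ∘ᶜ inWh Δ Σ = inWh (Γ ++ Δ) Σ
hole Γ   ∘ᶜ inBl Δ Σ = inBl (Γ ++ Δ) Σ
inWh Γ Σ ∘ᶜ Σ′       = inWh Γ (Σ ∘ᶜ Σ′)
inBl Γ Σ ∘ᶜ Σ′       = inBl Γ (Σ ∘ᶜ Σ′)

∘ᶜ-⟦⟧ : ∀ Σ Σ′ Γ → (Σ ∘ᶜ Σ′) ⟦ Γ ⟧ ≡ Σ ⟦ Σ′ ⟦ Γ ⟧ ⟧
∘ᶜ-⟦⟧ (hole Δ)   (hole Θ)    Γ = ++-assoc Δ Θ Γ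
∘ᶜ-⟦⟧ (hole Δ)   (inWh Θ Σ′) Γ = ++-assoc Δ Θ _
∘ᶜ-⟦⟧ (hole Δ)   (inBl Θ Σ′) Γ = ++-assoc Δ Θ _
∘ᶜ-⟦⟧ (inWh Δ Σ) Σ′          Γ = cong (λ Θ → Δ ++ [ wh Θ ]) (∘ᶜ-⟦⟧ Σ Σ′ Γ)
∘ᶜ-⟦⟧ (inBl Δ Σ) Σ′          Γ = cong (λ Θ → Δ ++ [ bl Θ ]) (∘ᶜ-⟦⟧ Σ Σ′ Γ)

infix 4 _⇐_ _⟸_

-- A derived rule with its conclusion on the left. Quantifying over contexts lets it be applied
-- inside any sequent.
_⇐_ : ∀ {I : Set} → Seq → (I → Seq) → Set
Γ ⇐ Γs = ∀ Σ → (∀ i → DS5 (Σ ⟦ Γs i ⟧)) → DS5 (Σ ⟦ Γ ⟧)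

_⟸_ : Seq → Seq → Set
Γ ⟸ Γ′ = Γ ⇐ λ (_ : ⊤) → Γ′

module _ {I : Set} where

  ⇐-resp : ∀ {Γ Γ′} {Γs Γs′ : I → Seq} → Γ ≃ Γ′ → (∀ i → Γs i ≃ Γs′ i) → Γ ⇐ Γs → Γ′ ⇐ Γs′
  ⇐-resp e es r Σ ds = mset (⟦⟧-cong Σ e) (r Σ (λ i → mset (≃-sym (⟦⟧-cong Σ (es i))) (ds i)))

  ⇐-⟦⟧ : ∀ {Γ} {Γs : I → Seq} Σ → Γ ⇐ Γs → Σ ⟦ Γ ⟧ ⇐ λ i → Σ ⟦ Γs i ⟧
  ⇐-⟦⟧ Σ′ r Σ ds = subst DS5 (∘ᶜ-⟦⟧ Σ Σ′ _)
    (r (Σ ∘ᶜ Σ′) (λ i → subst DS5 (≡-sym (∘ᶜ-⟦⟧ Σ Σ′ _)) (ds i)))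

  ⇐-cons : ∀ {Γ} {Γs : I → Seq} x → Γ ⇐ Γs → x ∷ Γ ⇐ λ i → x ∷ Γs i
  ⇐-cons x = ⇐-⟦⟧ (hole [ x ])

  ⇐-++ : ∀ {Γ} {Γs : I → Seq} Δ → Γ ⇐ Γs → Γ ++ Δ ⇐ λ i → Γs i ++ Δ
  ⇐-++ Δ r = ⇐-resp (++-comm Δ _) (λ i → ++-comm Δ _) (⇐-⟦⟧ (hole Δ) r)

  ⇐-wh : ∀ {Γ} {Γs : I → Seq} Δ → Γ ⇐ Γs → wh Γ ∷ Δ ⇐ λ i → wh (Γs i) ∷ Δ
  ⇐-wh Δ r = ⇐-resp (++-comm Δ _) (λ i → ++-comm Δ _) (⇐-⟦⟧ (inWh Δ (hole [])) r)

  ⇐-bl : ∀ {Γ} {Γs : I → Seq} Δ → Γ ⇐ Γs → bl Γ ∷ Δ ⇐ λ i → bl (Γs i) ∷ Δ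
  ⇐-bl Δ r = ⇐-resp (++-comm Δ _) (λ i → ++-comm Δ _) (⇐-⟦⟧ (inBl Δ (hole [])) r)

  principal : ∀ {x Γ} (E : I → Seq) → x ∈ Γ → [ x ] ⇐ (λ i → x ∷ E i) → Γ ⇐ λ i → E i ++ Γ
  principal {x} {_ ∷ Γ} E (here refl) r = ⇐-resp ≃-refl (λ i → shift x (E i) Γ) (⇐-++ Γ r)
  principal {x} {y ∷ Γ} E (there m)   r =
    ⇐-resp ≃-refl (λ i → shift y (E i) Γ) (⇐-cons y (principal E m r))

⟸-refl : ∀ {Γ} → Γ ⟸ Γ
⟸-refl Σ d = d tt

infixr 5 _⟫_
_⟫_ : ∀ {Γ Δ Θ} → Γ ⟸ Δ → Δ ⟸ Θ → Γ ⟸ Θ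
(r ⟫ s) Σ d = r Σ (λ _ → s Σ d)

⟸-perm : ∀ {Γ Δ} → Γ ≃ Δ → Γ ⟸ Δ
⟸-perm e Σ d = mset (⟦⟧-cong Σ (≃-sym e)) (d tt)

mutual
  data Pos (Γ : Seq) : Set where
    root : Pos Γ
    sub  : Sub Γ → Pos Γ

  data Sub : Seq → Set where
    inW  : ∀ {Δ Γ} → Pos Δ → Sub (wh Δ ∷ Γ)
    inB  : ∀ {Δ Γ} → Pos Δ → Sub (bl Δ ∷ Γ)
    skip : ∀ {x Γ} → Sub Γ → Sub (x ∷ Γ)

mutual
  node : ∀ {Γ} → Pos Γ → Seq
  node {Γ} root = Γ
  node (sub s)  = nodeS s

  nodeS : ∀ {Γ} → Sub Γ → Seq
  nodeS (inW p)  = node p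
  nodeS (inB p)  = node p
  nodeS (skip s) = nodeS s

-- Only membership of formulae is kept: substructures grow along with their nodes.
record _⊑_ (Γ Δ : Seq) : Set where
  field
    move  : Pos Γ → Pos Δ
    keeps : ∀ p {A} → fm A ∈ node p → fm A ∈ node (move p)
open _⊑_

skips : ∀ E {Γ} → Sub Γ → Sub (E ++ Γ)
skips []      s = s
skips (_ ∷ E) s = skip (skips E s)

nodeS-skips : ∀ E {Γ} (s : Sub Γ) → nodeS (skips E s) ≡ nodeS s
nodeS-skips []      s = refl
nodeS-skips (_ ∷ E) s = nodeS-skips E s

mutual
  graft : ∀ {Γ} → Pos Γ → Seq → Seq
  graft {Γ} root E = E ++ Γ
  graft (sub s)  E = graftS s E

  graftS : ∀ {Γ} → Sub Γ → Seq → Seq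
  graftS (inW {Γ = Γ} p) E = wh (graft p E) ∷ Γ
  graftS (inB {Γ = Γ} p) E = bl (graft p E) ∷ Γ
  graftS (skip {x} s)    E = x ∷ graftS s E

mutual
  graft-move : ∀ {Γ} (p : Pos Γ) E → Pos Γ → Pos (graft p E)
  graft-move root    E root    = root
  graft-move root    E (sub s) = sub (skips E s)
  graft-move (sub s) E root    = root
  graft-move (sub s) E (sub t) = sub (graftS-move s E t)

  graftS-move : ∀ {Γ} (s : Sub Γ) E → Sub Γ → Sub (graftS s E)
  graftS-move (inW p)  E (inW q)  = inW (graft-move p E q)
  graftS-move (inW p)  E (skip t) = skip t
  graftS-move (inB p)  E (inB q)  = inB (graft-move p E q)
  graftS-move (inB p)  E (skip t) = skip t
  graftS-move (skip s) E (inW q)  = inW q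
  graftS-move (skip s) E (inB q)  = inB q
  graftS-move (skip s) E (skip t) = skip (graftS-move s E t)

graftS-fm : ∀ {Γ} (s : Sub Γ) E {A} → fm A ∈ Γ → fm A ∈ graftS s E
graftS-fm (inW p)  E (there m)   = there m
graftS-fm (inB p)  E (there m)   = there m
graftS-fm (skip s) E (here refl) = here refl
graftS-fm (skip s) E (there m)   = there (graftS-fm s E m)

mutual
  graft-keeps : ∀ {Γ} (p : Pos Γ) E q {A} → fm A ∈ node q → fm A ∈ node (graft-move p E q)
  graft-keeps root    E root    m = ∈-++⁺ʳ E m
  graft-keeps root    E (sub s) m rewrite nodeS-skips E s = m
  graft-keeps (sub s) E root    m = graftS-fm s E m
  graft-keeps (sub s) E (sub t) m = graftS-keeps s E t m

  graftS-keeps : ∀ {Γ} (s : Sub Γ) E t {A} → fm A ∈ nodeS t → fm A ∈ nodeS (graftS-move s E t)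
  graftS-keeps (inW p)  E (inW q)  m = graft-keeps p E q m
  graftS-keeps (inW p)  E (skip t) m = m
  graftS-keeps (inB p)  E (inB q)  m = graft-keeps p E q m
  graftS-keeps (inB p)  E (skip t) m = m
  graftS-keeps (skip s) E (inW q)  m = m
  graftS-keeps (skip s) E (inB q)  m = m
  graftS-keeps (skip s) E (skip t) m = graftS-keeps s E t m

graft-⊑ : ∀ {Γ} (p : Pos Γ) E → Γ ⊑ graft p E
graft-⊑ p E = record { move = graft-move p E ; keeps = graft-keeps p E }

mutual
  graft-new : ∀ {Γ} (p : Pos Γ) E {x} → x ∈ E → x ∈ node (graft-move p E p)
  graft-new root    E m = ∈-++⁺ˡ m
  graft-new (sub s) E m = graftS-new s E m

  graftS-new : ∀ {Γ} (s : Sub Γ) E {x} → x ∈ E → x ∈ nodeS (graftS-move s E s)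
  graftS-new (inW p)  E m = graft-new p E m
  graftS-new (inB p)  E m = graft-new p E m
  graftS-new (skip s) E m = graftS-new s E m

mutual
  graft-sub : ∀ {Γ} (p : Pos Γ) {x} → Sub [ x ] → Sub (graft p [ x ])
  graft-sub root (inW q) = inW q
  graft-sub root (inB q) = inB q
  graft-sub (sub s) t = graftS-sub s t

  graftS-sub : ∀ {Γ} (s : Sub Γ) {x} → Sub [ x ] → Sub (graftS s [ x ])
  graftS-sub (inW p)  t = inW (sub (graft-sub p t))
  graftS-sub (inB p)  t = inB (sub (graft-sub p t))
  graftS-sub (skip s) t = skip (graftS-sub s t)

mutual
  node-graft-sub : ∀ {Γ} (p : Pos Γ) {x} (t : Sub [ x ]) → nodeS (graft-sub p t) ≡ nodeS t
  node-graft-sub root    (inW q) = refl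
  node-graft-sub root    (inB q) = refl
  node-graft-sub (sub s) t       = node-graftS-sub s t

  node-graftS-sub : ∀ {Γ} (s : Sub Γ) {x} (t : Sub [ x ]) → nodeS (graftS-sub s t) ≡ nodeS t
  node-graftS-sub (inW p)  t = node-graft-sub p t
  node-graftS-sub (inB p)  t = node-graft-sub p t
  node-graftS-sub (skip s) t = node-graftS-sub s t

module _ {I : Set} (E : I → Seq) where
  mutual
    graft-⇐ : ∀ {Γ} (p : Pos Γ) → node p ⇐ (λ i → E i ++ node p) → Γ ⇐ λ i → graft p (E i)
    graft-⇐ root    r = r
    graft-⇐ (sub s) r = graftS-⇐ s r

    graftS-⇐ : ∀ {Γ} (s : Sub Γ) → nodeS s ⇐ (λ i → E i ++ nodeS s) → Γ ⇐ λ i → graftS s (E i)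
    graftS-⇐ (inW {Γ = Γ} p) r = ⇐-wh Γ (graft-⇐ p r)
    graftS-⇐ (inB {Γ = Γ} p) r = ⇐-bl Γ (graft-⇐ p r)
    graftS-⇐ (skip {x} s)    r = ⇐-cons x (graftS-⇐ s r)

  at-node : ∀ {Γ x} (p : Pos Γ) → x ∈ node p → [ x ] ⇐ (λ i → x ∷ E i) →
            (∀ i → DS5 (graft p (E i))) → DS5 Γ
  at-node p m r = graft-⇐ p (principal E m r) (hole [])

last : ∀ {x : Item} {Γ} → x ∈ Γ → ∃[ Δ ] (Δ ++ [ x ]) ≃ Γ
last {x} {_ ∷ Γ} (here refl) = Γ , ++-comm Γ [ x ]
last {x} {y ∷ Γ} (there m)   = let Δ , e = last m in y ∷ Δ , ≅-refl ∷ e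

last₂ : ∀ {x y : Item} {Γ} → x ∈ Γ → y ∈ Γ → (x ≡ y → ⊥) → ∃[ Δ ] (Δ ++ x ∷ y ∷ []) ≃ Γ
last₂ (here refl) (here refl) x≢y = ⊥-elim (x≢y refl)
last₂ {x} {y} (here refl) (there n) _ =
  let Δ , e = last n in Δ , trans (≃-sym (shift x Δ [ y ])) (≅-refl ∷ e)
last₂ {x} {y} (there m) (here refl) _ =
  let Δ , e = last m in
  Δ , trans (++-congˡ Δ (swap x y [])) (trans (≃-sym (shift y Δ [ x ])) (≅-refl ∷ e))
last₂ {Γ = z ∷ Γ} (there m) (there n) x≢y = let Δ , e = last₂ m n x≢y in z ∷ Δ , ≅-refl ∷ e

clash : ∀ {Γ a} (p : Pos Γ) → fm (at a) ∈ node p → fm (na a) ∈ node p → DS5 Γ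
clash {a = a} p m n = let Δ , e = last₂ m n (λ ()) in
  graft-⇐ {⊥} (λ ()) p
    (λ Σ _ → mset (⟦⟧-cong Σ e) (subst DS5 (∘ᶜ-⟦⟧ Σ (hole Δ) _) (id (Σ ∘ᶜ hole Δ) a)))
    (hole []) (λ ())

-- Copying a diamond to every node, without duplicating it at its own node: contraction is not a
-- rule of DS5.
module Spread (D : Fm → Fm)
  (T       : ∀ A   → [ fm (D A) ] ⟸ fm (D A) ∷ fm A ∷ [])
  (wh-down : ∀ A Δ → fm (D A) ∷ wh Δ ∷ [] ⟸ fm (D A) ∷ wh (fm (D A) ∷ Δ) ∷ [])
  (bl-down : ∀ A Δ → fm (D A) ∷ bl Δ ∷ [] ⟸ fm (D A) ∷ bl (fm (D A) ∷ Δ) ∷ [])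
  (wh-up   : ∀ A Δ → [ wh (Δ ++ [ fm (D A) ]) ] ⟸ wh (Δ ++ [ fm (D A) ]) ∷ fm (D A) ∷ [])
  (bl-up   : ∀ A Δ → [ bl (Δ ++ [ fm (D A) ]) ] ⟸ bl (Δ ++ [ fm (D A) ]) ∷ fm (D A) ∷ [])
  (A : Fm) where

  mutual
    spreadI : Item → Item
    spreadI (fm C) = fm C
    spreadI (wh Δ) = wh (fm (D A) ∷ fm A ∷ spread Δ)
    spreadI (bl Δ) = bl (fm (D A) ∷ fm A ∷ spread Δ)

    spread : Seq → Seq
    spread []      = []
    spread (x ∷ Γ) = spreadI x ∷ spread Γ

  mutual
    spread-from : ∀ {Γ} → Pos Γ → Seq
    spread-from {Γ} root = fm A ∷ spread Γ
    spread-from (sub s)  = fm (D A) ∷ fm A ∷ spread-fromS s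

    spread-fromS : ∀ {Γ} → Sub Γ → Seq
    spread-fromS (inW {Γ = Γ} p) = wh (spread-from p) ∷ spread Γ
    spread-fromS (inB {Γ = Γ} p) = bl (spread-from p) ∷ spread Γ
    spread-fromS (skip {x} s)    = spreadI x ∷ spread-fromS s

  mutual
    spread-move : ∀ {Γ} → Pos Γ → Pos (fm (D A) ∷ fm A ∷ spread Γ)
    spread-move root    = root
    spread-move (sub s) = sub (skip (skip (spread-moveS s)))

    spread-moveS : ∀ {Γ} → Sub Γ → Sub (spread Γ)
    spread-moveS (inW p)  = inW (spread-move p)
    spread-moveS (inB p)  = inB (spread-move p)
    spread-moveS (skip s) = skip (spread-moveS s)

  mutual
    move-from : ∀ {Γ} (p : Pos Γ) → Pos Γ → Pos (spread-from p)
    move-from root    root    = root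
    move-from root    (sub s) = sub (skip (spread-moveS s))
    move-from (sub s) root    = root
    move-from (sub s) (sub t) = sub (skip (skip (move-fromS s t)))

    move-fromS : ∀ {Γ} (s : Sub Γ) → Sub Γ → Sub (spread-fromS s)
    move-fromS (inW p)  (inW q)  = inW (move-from p q)
    move-fromS (inW p)  (skip t) = skip (spread-moveS t)
    move-fromS (inB p)  (inB q)  = inB (move-from p q)
    move-fromS (inB p)  (skip t) = skip (spread-moveS t)
    move-fromS (skip s) (inW q)  = inW (spread-move q)
    move-fromS (skip s) (inB q)  = inB (spread-move q)
    move-fromS (skip s) (skip t) = skip (move-fromS s t)

  spread-fm : ∀ {Γ C} → fm C ∈ Γ → fm C ∈ spread Γ
  spread-fm (here refl) = here refl
  spread-fm (there m)   = there (spread-fm m)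

  spread-fromS-fm : ∀ {Γ} (s : Sub Γ) {C} → fm C ∈ Γ → fm C ∈ spread-fromS s
  spread-fromS-fm (inW p)  (there m)   = there (spread-fm m)
  spread-fromS-fm (inB p)  (there m)   = there (spread-fm m)
  spread-fromS-fm (skip s) (here refl) = here refl
  spread-fromS-fm (skip s) (there m)   = there (spread-fromS-fm s m)

  mutual
    spread-keeps : ∀ {Γ} (p : Pos Γ) {C} → fm C ∈ fm A ∷ node p → fm C ∈ node (spread-move p)
    spread-keeps root    (here e)  = there (here e)
    spread-keeps root    (there m) = there (there (spread-fm m))
    spread-keeps (sub s) m         = spread-keepsS s m

    spread-keepsS : ∀ {Γ} (s : Sub Γ) {C} → fm C ∈ fm A ∷ nodeS s → fm C ∈ nodeS (spread-moveS s)
    spread-keepsS (inW p)  = spread-keeps p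
    spread-keepsS (inB p)  = spread-keeps p
    spread-keepsS (skip s) = spread-keepsS s

  mutual
    from-keeps : ∀ {Γ} (p q : Pos Γ) {C} → fm C ∈ fm A ∷ node q → fm C ∈ node (move-from p q)
    from-keeps root    root    (here e)  = here e
    from-keeps root    root    (there m) = there (spread-fm m)
    from-keeps root    (sub s) m         = spread-keepsS s m
    from-keeps (sub s) root    (here e)  = there (here e)
    from-keeps (sub s) root    (there m) = there (there (spread-fromS-fm s m))
    from-keeps (sub s) (sub t) m         = from-keepsS s t m

    from-keepsS : ∀ {Γ} (s t : Sub Γ) {C} → fm C ∈ fm A ∷ nodeS t → fm C ∈ nodeS (move-fromS s t)
    from-keepsS (inW p)  (inW q)  = from-keeps p q
    from-keepsS (inW p)  (skip t) = spread-keepsS t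
    from-keepsS (inB p)  (inB q)  = from-keeps p q
    from-keepsS (inB p)  (skip t) = spread-keepsS t
    from-keepsS (skip s) (inW q)  = spread-keeps q
    from-keepsS (skip s) (inB q)  = spread-keeps q
    from-keepsS (skip s) (skip t) = from-keepsS s t

  spread-⊑ : ∀ {Γ} (p : Pos Γ) → Γ ⊑ spread-from p
  spread-⊑ p = record { move = move-from p ; keeps = λ q m → from-keeps p q (there m) }

  mutual
    spread-⟸ : ∀ Γ → fm (D A) ∷ Γ ⟸ fm (D A) ∷ spread Γ
    spread-⟸ []      = ⟸-refl
    spread-⟸ (x ∷ Γ) = ⇐-++ Γ (spreadI-⟸ x)
      ⟫ ⟸-perm (swap _ _ _) ⟫ ⇐-cons (spreadI x) (spread-⟸ Γ) ⟫ ⟸-perm (swap _ _ _)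

    spreadI-⟸ : ∀ x → fm (D A) ∷ x ∷ [] ⟸ fm (D A) ∷ spreadI x ∷ []
    spreadI-⟸ (fm C) = ⟸-refl
    spreadI-⟸ (wh Δ) = wh-down A Δ ⟫ ⇐-cons _ (⇐-wh [] (spread-⟸ Δ ⟫ ⇐-++ (spread Δ) (T A)))
    spreadI-⟸ (bl Δ) = bl-down A Δ ⟫ ⇐-cons _ (⇐-bl [] (spread-⟸ Δ ⟫ ⇐-++ (spread Δ) (T A)))

  root-⟸ : ∀ {Γ} → fm (D A) ∈ Γ → Γ ⟸ spread Γ
  root-⟸ {_ ∷ Γ} (here refl) = spread-⟸ Γ
  root-⟸ {x ∷ Γ} (there m)   =
    let Δ , e = last (spread-fm m)
        front = λ y → trans (swap _ y Δ) (≅-refl ∷ trans (++-comm [ fm (D A) ] Δ) e)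
    in ⇐-cons x (root-⟸ m) ⟫ ⇐-resp (front x) (λ _ → front (spreadI x)) (⇐-++ Δ (spreadI-⟸ x))

  wh-up′ : ∀ {Δ} → fm (D A) ∈ Δ → [ wh Δ ] ⟸ wh Δ ∷ fm (D A) ∷ []
  wh-up′ m = let Δ , e = last m in ⇐-resp ([wh] e) (λ _ → wh e ∷ ≃-refl) (wh-up A Δ)

  bl-up′ : ∀ {Δ} → fm (D A) ∈ Δ → [ bl Δ ] ⟸ bl Δ ∷ fm (D A) ∷ []
  bl-up′ m = let Δ , e = last m in ⇐-resp ([bl] e) (λ _ → bl e ∷ ≃-refl) (bl-up A Δ)

  from-D : ∀ {Γ} (p : Pos Γ) → fm (D A) ∈ node p → fm (D A) ∈ spread-from p
  from-D root    m = there (spread-fm m)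
  from-D (sub s) m = here refl

  mutual
    -- Copies climb the path from p to the root, one edge at a time, and at every ancestor descend
    -- into the branches off the path.
    from-⟸ : ∀ {Γ} (p : Pos Γ) → fm (D A) ∈ node p → Γ ⟸ spread-from p
    from-⟸ root    m = principal (λ _ → [ fm A ]) m (T A) ⟫ ⇐-cons _ (root-⟸ m)
    from-⟸ (sub s) m = from-⟸S s m ⟫ ⇐-++ (spread-fromS s) (T A)

    from-⟸S : ∀ {Γ} (s : Sub Γ) → fm (D A) ∈ nodeS s → Γ ⟸ fm (D A) ∷ spread-fromS s
    from-⟸S (inW {Γ = Γ} p) m = ⇐-wh Γ (from-⟸ p m) ⟫ ⇐-++ Γ (wh-up′ (from-D p m))
      ⟫ ⇐-cons _ (spread-⟸ Γ) ⟫ ⟸-perm (swap _ _ _)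
    from-⟸S (inB {Γ = Γ} p) m = ⇐-bl Γ (from-⟸ p m) ⟫ ⇐-++ Γ (bl-up′ (from-D p m))
      ⟫ ⇐-cons _ (spread-⟸ Γ) ⟫ ⟸-perm (swap _ _ _)
    from-⟸S (skip {x} s) m = ⇐-cons x (from-⟸S s m) ⟫ ⟸-perm (swap _ _ _)
      ⟫ ⇐-++ (spread-fromS s) (spreadI-⟸ x)

  everywhere : ∀ {Γ} (p : Pos Γ) → fm (D A) ∈ node p → DS5 (spread-from p) → DS5 Γ
  everywhere p m d = from-⟸ p m (hole []) (λ _ → d)

-- Finite models and soundness of SS5

-- Finite choice in one form for three purposes: evaluating modalities in a finite model, detecting
-- saturation, and collecting the premises of an expansion.
traverse : ∀ {A Q : Set} {P : A → Set} (xs : List A) →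
           (∀ {x} → x ∈ xs → P x ⊎ Q) → (∀ {x} → x ∈ xs → P x) ⊎ Q
traverse []       f = inj₁ λ ()
traverse (x ∷ xs) f with f (here refl) | traverse xs (f ∘ there)
... | inj₂ q | _      = inj₂ q
... | inj₁ _ | inj₂ q = inj₂ q
... | inj₁ p | inj₁ g = inj₁ λ { (here refl) → p ; (there m) → g m }

module Model {W : Set} (ws : List W) (val : W → ℕ → Bool) where

  -- Falsity is defined positively, so that countermodels are built without double negations.
  Fails : Fm → W → Set
  Fails (at a)  w = val w a ≡ false
  Fails (na a)  w = val w a ≡ true
  Fails (A ∨ C) w = Fails A w × Fails C w
  Fails (A ∧ C) w = Fails A w ⊎ Fails C w
  Fails (□ A)   w = ∃[ v ] v ∈ ws × Fails A v
  Fails (■ A)   w = ∃[ v ] v ∈ ws × Fails A v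
  Fails (◇ A)   w = ∀ {v} → v ∈ ws → Fails A v
  Fails (◆ A)   w = ∀ {v} → v ∈ ws → Fails A v

  mutual
    FailsI : Item → W → Set
    FailsI (fm A) w = Fails A w
    FailsI (wh Δ) w = ∃[ v ] v ∈ ws × FailsS Δ v
    FailsI (bl Δ) w = ∃[ v ] v ∈ ws × FailsS Δ v

    FailsS : Seq → W → Set
    FailsS []      w = ⊤
    FailsS (x ∷ Γ) w = FailsI x w × FailsS Γ w

  -- This is what soundness of `cut` rests on; the modal cases are decided by running through the
  -- finite list `ws`.
  fails-neg : ∀ A w → Fails A w ⊎ Fails (neg A) w
  some-or-all : ∀ A → (∃[ v ] v ∈ ws × Fails A v) ⊎ (∀ {v} → v ∈ ws → Fails (neg A) v)
  all-or-some : ∀ A → (∀ {v} → v ∈ ws → Fails A v) ⊎ (∃[ v ] v ∈ ws × Fails (neg A) v)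

  fails-neg (at a) w with val w a
  ... | true  = inj₂ refl
  ... | false = inj₁ refl
  fails-neg (na a) w with val w a
  ... | true  = inj₁ refl
  ... | false = inj₂ refl
  fails-neg (A ∨ C) w with fails-neg A w | fails-neg C w
  ... | inj₁ f | inj₁ g = inj₁ (f , g)
  ... | inj₂ f | _      = inj₂ (inj₁ f)
  ... | _      | inj₂ g = inj₂ (inj₂ g)
  fails-neg (A ∧ C) w with fails-neg A w | fails-neg C w
  ... | inj₁ f | _      = inj₁ (inj₁ f)
  ... | _      | inj₁ g = inj₁ (inj₂ g)
  ... | inj₂ f | inj₂ g = inj₂ (f , g)
  fails-neg (□ A) w = some-or-all A
  fails-neg (■ A) w = some-or-all A
  fails-neg (◇ A) w = all-or-some A
  fails-neg (◆ A) w = all-or-some A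

  some-or-all A = ⊎-swap (traverse ws λ {v} m → map₂ (λ f → v , m , f) (⊎-swap (fails-neg A v)))

  all-or-some A = traverse ws λ {v} m → map₂ (λ f → v , m , f) (fails-neg A v)

  mutual
    FailsS-resp : ∀ {Γ Δ w} → Γ ≃ Δ → FailsS Γ w → FailsS Δ w
    FailsS-resp []           fs            = fs
    FailsS-resp (e ∷ es)     (f , fs)      = FailsI-resp e f , FailsS-resp es fs
    FailsS-resp (swap x y Γ) (f , g , fs)  = g , f , fs
    FailsS-resp (trans d e)  fs            = FailsS-resp e (FailsS-resp d fs)

    FailsI-resp : ∀ {x y w} → x ≅ y → FailsI x w → FailsI y w
    FailsI-resp (fm A) f           = f
    FailsI-resp (wh e) (v , m , f) = v , m , FailsS-resp e f
    FailsI-resp (bl e) (v , m , f) = v , m , FailsS-resp e f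

  ++⁺ : ∀ Γ {Δ w} → FailsS Γ w → FailsS Δ w → FailsS (Γ ++ Δ) w
  ++⁺ []      _        gs = gs
  ++⁺ (x ∷ Γ) (f , fs) gs = f , ++⁺ Γ fs gs

  ++⁻ : ∀ Γ {Δ w} → FailsS (Γ ++ Δ) w → FailsS Γ w × FailsS Δ w
  ++⁻ []      gs       = tt , gs
  ++⁻ (x ∷ Γ) (f , fs) = let gs , hs = ++⁻ Γ fs in (f , gs) , hs

  sound : ∀ {Γ w} → w ∈ ws → SS5 Γ → ¬ FailsS Γ w
  sound m (mset e d) fs = sound m d (FailsS-resp (≃-sym e) fs)
  sound m (id Γ a) fs with ++⁻ Γ fs
  ... | _ , p , q , _ with ≡-sym p
  ...   | p′ rewrite q with p′
  ...     | ()
  sound {w = w} m (cut Γ A d e) fs with fails-neg A w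
  ... | inj₁ f = sound m d (++⁺ Γ fs (f , tt))
  ... | inj₂ f = sound m e (++⁺ Γ fs (f , tt))
  sound m (∧r Γ A C d e) fs with ++⁻ Γ fs
  ... | gs , inj₁ f , _ = sound m d (++⁺ Γ gs (f , tt))
  ... | gs , inj₂ f , _ = sound m e (++⁺ Γ gs (f , tt))
  sound m (∨r Γ A C d) fs = let gs , (f , g) , _ = ++⁻ Γ fs in sound m d (++⁺ Γ gs (f , g , tt))
  sound m (ctr Γ Δ d) fs = let gs , hs = ++⁻ Γ fs in sound m d (++⁺ Γ gs (++⁺ Δ hs hs))
  sound m (wk Γ Δ d) fs = sound m d (proj₁ (++⁻ Γ fs))
  -- The relation is symmetric: the witness v becomes the point of evaluation, and the former point
  -- becomes the witness.
  sound m (rf Γ Δ d) ((v , n , gs) , hs) = sound n d (++⁺ Γ gs ((_ , m , hs) , tt))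
  sound m (rp Γ Δ d) ((v , n , gs) , hs) = sound n d (++⁺ Γ gs ((_ , m , hs) , tt))
  sound m (■r Γ A d) fs = let gs , (v , n , f) , _ = ++⁻ Γ fs in
    sound m d (++⁺ Γ gs ((v , n , f , tt) , tt))
  sound m (□r Γ A d) fs = let gs , (v , n , f) , _ = ++⁻ Γ fs in
    sound m d (++⁺ Γ gs ((v , n , f , tt) , tt))
  sound m (◆r Γ Δ A d) fs = let gs , (v , n , hs) , f , _ = ++⁻ Γ fs in
    sound m d (++⁺ Γ gs ((v , n , ++⁺ Δ hs (f n , tt)) , tt))
  sound m (◇r Γ Δ A d) fs = let gs , (v , n , hs) , f , _ = ++⁻ Γ fs in
    sound m d (++⁺ Γ gs ((v , n , ++⁺ Δ hs (f n , tt)) , tt))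
  sound m (Tf Γ Δ d) fs = let gs , hs = ++⁻ Γ fs in sound m d (++⁺ Γ gs ((_ , m , hs) , tt))
  sound m (4f Γ Δ d) fs = let gs , (_ , _ , f , _) , _ = ++⁻ Γ fs in sound m d (++⁺ Γ gs (f , tt))
  sound m (B Γ Δ d) fs = sound m d fs′
    where fs′ = let gs , f , _ = ++⁻ Γ fs in ++⁺ Γ gs (f , tt)

-- Labelled proof search

tag : Fm → ℕ
tag (at _)  = 0
tag (na _)  = 1
tag (_ ∨ _) = 2
tag (_ ∧ _) = 3
tag (□ _)   = 4
tag (■ _)   = 5
tag (◇ _)   = 6
tag (◆ _)   = 7

-- Comparing tags first settles all mixed pairs of constructors in one clause and leaves only the
-- eight diagonal ones.
compare : ∀ A C → Dec (tag A ≡ tag C) → Dec (A ≡ C)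
compare A        C        (no t≢)    = no λ { refl → t≢ refl }
compare (at a)   (at b)   (yes refl) = map′ (cong at) (λ { refl → refl }) (a ℕ.≟ b)
compare (na a)   (na b)   (yes refl) = map′ (cong na) (λ { refl → refl }) (a ℕ.≟ b)
compare (A ∨ A′) (C ∨ C′) (yes refl) = map′ (λ { (refl , refl) → refl }) (λ { refl → refl , refl })
  (compare A C (tag A ℕ.≟ tag C) ×-dec compare A′ C′ (tag A′ ℕ.≟ tag C′))
compare (A ∧ A′) (C ∧ C′) (yes refl) = map′ (λ { (refl , refl) → refl }) (λ { refl → refl , refl })
  (compare A C (tag A ℕ.≟ tag C) ×-dec compare A′ C′ (tag A′ ℕ.≟ tag C′))
compare (□ A)    (□ C)    (yes refl) =
  map′ (cong □) (λ { refl → refl }) (compare A C (tag A ℕ.≟ tag C))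
compare (■ A)    (■ C)    (yes refl) =
  map′ (cong ■) (λ { refl → refl }) (compare A C (tag A ℕ.≟ tag C))
compare (◇ A)    (◇ C)    (yes refl) =
  map′ (cong ◇) (λ { refl → refl }) (compare A C (tag A ℕ.≟ tag C))
compare (◆ A)    (◆ C)    (yes refl) =
  map′ (cong ◆) (λ { refl → refl }) (compare A C (tag A ℕ.≟ tag C))

infix 4 _≟_
_≟_ : DecidableEquality Fm
A ≟ C = compare A C (tag A ℕ.≟ tag C)

-- (i , A): the formula A is to fail at world i. A world is named by the formula it was created for.
Fact : Set
Fact = Fm × Fm

open DecMembership (Product.≡-dec _≟_ _≟_) using (_∈?_)

-- or and box let the root of Γ hold the formula ⌜ Γ ⌝ below, which does not occur in Γ.
data Has {Γ : Seq} : Pos Γ → Fm → Set where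
  real : ∀ {p A} → fm A ∈ node p → Has p A
  or   : ∀ {p A C} → Has p A → Has p C → Has p (A ∨ C)
  box  : ∀ {p A} (q : Pos Γ) → Has q A → Has p (□ A)

Has-move : ∀ {Γ Δ p A} (g : Γ ⊑ Δ) → Has p A → Has (move g p) A
Has-move g (real m)  = real (keeps g _ m)
Has-move g (or h k)  = or (Has-move g h) (Has-move g k)
Has-move g (box q h) = box (move g q) (Has-move g h)

Covers : ∀ {Γ} → (Fm → Pos Γ) → List Fact → Set
Covers ρ X = ∀ {i A} → (i , A) ∈ X → Has (ρ i) A

-- Rules make Γ grow and shift its nodes, so Γ and ρ are quantified. Several labels may share a
-- node, and nodes may hold more than the facts demand.
Provable : List Fact → Set
Provable X = ∀ {Γ} (ρ : Fm → Pos Γ) → Covers ρ X → DS5 Γ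

cover-move : ∀ {Γ Δ ρ X} (g : Γ ⊑ Δ) → Covers ρ X → Covers (move g ∘ ρ) X
cover-move g c m = Has-move g (c m)

cover-∷ : ∀ {Γ} {ρ : Fm → Pos Γ} {X i A} → Has (ρ i) A → Covers ρ X → Covers ρ ((i , A) ∷ X)
cover-∷ h c (here refl) = h
cover-∷ h c (there m)   = c m

infixl 6 _[_↦_]
_[_↦_] : ∀ {P : Set} → (Fm → P) → Fm → P → Fm → P
(ρ [ i ↦ p ]) j = if does (j ≟ i) then p else ρ j

-- Since no fact carries the label A yet, redirecting A to p disturbs no earlier fact.
cover-↦ : ∀ {Γ} {ρ : Fm → Pos Γ} {X A p} → (∀ {C} → (A , C) ∉ X) → Has p A →
          Covers ρ X → Covers (ρ [ A ↦ p ]) ((A , A) ∷ X)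
cover-↦ {A = A} fresh h c (here refl) rewrite dec-true (A ≟ A) refl = h
cover-↦ {A = A} fresh h c {i} (there m) with i ≟ A
... | yes refl = contradiction m fresh
... | no  _    = c m

provable-clash : ∀ {X i a} → (i , at a) ∈ X → (i , na a) ∈ X → Provable X
provable-clash m n ρ c with c m | c n
... | real p | real q = clash (ρ _) p q

cover-graft : ∀ {Γ} {ρ : Fm → Pos Γ} {X i A} E → fm A ∈ E → Covers ρ X →
              Covers (move (graft-⊑ (ρ i) E) ∘ ρ) ((i , A) ∷ X)
cover-graft {ρ = ρ} {i = i} E m c =
  cover-∷ (real (graft-new (ρ i) E m)) (cover-move (graft-⊑ (ρ i) E) c)

provable-∧ : ∀ {X i A C} → (i , A ∧ C) ∈ X →
             Provable ((i , A) ∷ X) → Provable ((i , C) ∷ X) → Provable X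
provable-∧ {i = i} {A} {C} m d e ρ c with c m
... | real n = at-node E (ρ i) n (λ Σ ds → ∧r Σ A C (ds true) (ds false)) λ
      { true  → d _ (cover-graft (E true) (here refl) c)
      ; false → e _ (cover-graft (E false) (here refl) c) }
  where
  E : Bool → Seq
  E b = [ fm (if b then A else C) ]

provable-∨ : ∀ {X i A C K} → (i , A ∨ C) ∈ X → K ≡ A ⊎ K ≡ C →
             Provable ((i , K) ∷ X) → Provable X
provable-∨ m K∈ d ρ c with c m | K∈
-- A virtual disjunction is already split into its parts, so no rule is applied to Γ.
... | or h k | inj₁ refl = d ρ (cover-∷ h c)
... | or h k | inj₂ refl = d ρ (cover-∷ k c)
provable-∨ {i = i} {A} {C} m K∈ d ρ c | real n | _ =
  at-node {⊤} (λ _ → E) (ρ i) n (λ Σ ds → ∨r Σ A C (ds tt)) λ _ → d _ (cover-graft E (pick K∈) c)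
  where
  E : Seq
  E = fm A ∷ fm C ∷ []
  pick : ∀ {K} → K ≡ A ⊎ K ≡ C → fm K ∈ E
  pick (inj₁ refl) = here refl
  pick (inj₂ refl) = there (here refl)

grow : ∀ {X Γ x A} (ρ : Fm → Pos Γ) p (t : Sub [ x ]) → nodeS t ≡ [ fm A ] → (∀ {C} → (A , C) ∉ X) →
       Covers ρ X → Provable ((A , A) ∷ X) → DS5 (graft p [ x ])
grow {x = x} {A} ρ p t eq fresh c d =
  d ((move (graft-⊑ p [ x ]) ∘ ρ) [ A ↦ sub (graft-sub p t) ])
    (cover-↦ fresh (real (subst (fm A ∈_) (≡-sym (≡-trans (node-graft-sub p t) eq)) (here refl)))
      (cover-move (graft-⊑ p [ x ]) c))

provable-□ : ∀ {X i A} → (i , □ A) ∈ X → (∀ {C} → (A , C) ∉ X) → Provable ((A , A) ∷ X) → Provable X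
provable-□ {i = i} {A} m fresh d ρ c with c m
-- A virtual box stands for an existing structure: its node q serves as the world named A.
... | box q h = d (ρ [ A ↦ q ]) (cover-↦ fresh h c)
... | real n  = at-node {⊤} _ (ρ i) n (λ Σ ds → □r Σ A (ds tt))
                  λ _ → grow ρ (ρ i) (inW root) refl fresh c d

provable-■ : ∀ {X i A} → (i , ■ A) ∈ X → (∀ {C} → (A , C) ∉ X) → Provable ((A , A) ∷ X) → Provable X
provable-■ {i = i} {A} m fresh d ρ c with c m
... | real n  = at-node {⊤} _ (ρ i) n (λ Σ ds → ■r Σ A (ds tt))
                  λ _ → grow ρ (ρ i) (inB root) refl fresh c d

module _ (A : Fm) where
  module S◇ = Spread ◇
    (λ A Σ d → Tb Σ A (d tt))
    (λ A Δ Σ d → 4c Σ Δ A (d tt))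
    (λ A Δ Σ d → 5c Σ Δ A (d tt))
    (λ A Δ Σ d → 5b Σ Δ A (d tt))
    (λ A Δ Σ d → 4d Σ Δ A (d tt)) A
  module S◆ = Spread ◆
    (λ A Σ d → Ta Σ A (d tt))
    (λ A Δ Σ d → 5a Σ Δ A (d tt))
    (λ A Δ Σ d → 4a Σ Δ A (d tt))
    (λ A Δ Σ d → 4b Σ Δ A (d tt))
    (λ A Δ Σ d → 5d Σ Δ A (d tt)) A

  provable-◇ : ∀ {X i j} → (i , ◇ A) ∈ X → Provable ((j , A) ∷ X) → Provable X
  provable-◇ {i = i} {j} m d ρ c with c m
  ... | real n = S◇.everywhere (ρ i) n (d _ (cover-∷
          (real (S◇.from-keeps (ρ i) (ρ j) (here refl))) (cover-move (S◇.spread-⊑ (ρ i)) c)))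

  provable-◆ : ∀ {X i j} → (i , ◆ A) ∈ X → Provable ((j , A) ∷ X) → Provable X
  provable-◆ {i = i} {j} m d ρ c with c m
  ... | real n = S◆.everywhere (ρ i) n (d _ (cover-∷
          (real (S◆.from-keeps (ρ i) (ρ j) (here refl))) (cover-move (S◆.spread-⊑ (ρ i)) c)))

-- Subformulae, saturation and termination of the search

mutual
  subs : Fm → List Fm
  subs A = A ∷ below A

  below : Fm → List Fm
  below (at a)  = []
  below (na a)  = []
  below (A ∨ C) = subs A ++ subs C
  below (A ∧ C) = subs A ++ subs C
  below (□ A)   = subs A
  below (■ A)   = subs A
  below (◇ A)   = subs A
  below (◆ A)   = subs A

mutual
  subs-closed : ∀ A {C} → C ∈ subs A → below C ⊆ subs A
  subs-closed A (here refl) k = there k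
  subs-closed A (there m)   k = there (below-closed A m k)

  below-closed : ∀ A {C} → C ∈ below A → below C ⊆ below A
  below-closed (A ∨ A′) m k = below-closed₂ A A′ m k
  below-closed (A ∧ A′) m k = below-closed₂ A A′ m k
  below-closed (□ A) m = subs-closed A m
  below-closed (■ A) m = subs-closed A m
  below-closed (◇ A) m = subs-closed A m
  below-closed (◆ A) m = subs-closed A m

  below-closed₂ : ∀ A A′ {C} → C ∈ subs A ++ subs A′ → below C ⊆ subs A ++ subs A′
  below-closed₂ A A′ m k with ∈-++⁻ (subs A) m
  ... | inj₁ n = ∈-++⁺ˡ (subs-closed A n k)
  ... | inj₂ n = ∈-++⁺ʳ (subs A) (subs-closed A′ n k)

-- Hintikka conditions for a universal relation. The valuation in `Truth` makes an atom true exactly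
-- where its negation is a fact, so consistency is demanded at `at a`. The world named A serves all
-- boxes over A.
Saturated : List Fact → Fact → Set
Saturated X (i , at a)  = (i , na a) ∉ X
Saturated X (i , na a)  = ⊤
Saturated X (i , A ∨ C) = (i , A) ∈ X × (i , C) ∈ X
Saturated X (i , A ∧ C) = (i , A) ∈ X ⊎ (i , C) ∈ X
Saturated X (i , □ A)   = (A , A) ∈ X
Saturated X (i , ■ A)   = (A , A) ∈ X
Saturated X (i , ◇ A)   = ∀ {j} → j ∈ map proj₁ X → (j , A) ∈ X
Saturated X (i , ◆ A)   = ∀ {j} → j ∈ map proj₁ X → (j , A) ∈ X

module Search (A₀ : Fm) where

  InRange : Fact → Set
  InRange (i , A) = i ∈ subs A₀ × A ∈ subs A₀

  -- The second component turns the absence of the fact (A , A) into the absence of the label A, the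
  -- freshness that `provable-□` and `provable-■` ask for.
  WellLabelled : List Fact → Set
  WellLabelled X = ∀ {i A} → (i , A) ∈ X → InRange (i , A) × (i , i) ∈ X

  New : List Fact → Fact → Set
  New X f = f ∉ X × InRange f × (proj₁ f , proj₁ f) ∈ f ∷ X

  -- One backward step whose premises each add a single fact; an empty list closes the branch.
  Expansion : List Fact → Set
  Expansion X =
    ∃[ fs ] (∀ {f} → f ∈ fs → New X f) × ((∀ {f} → f ∈ fs → Provable (f ∷ X)) → Provable X)

  expand₁ : ∀ {X f} → New X f → (Provable (f ∷ X) → Provable X) → Expansion X
  expand₁ {f = f} ν r = [ f ] , (λ { (here refl) → ν }) , λ ds → r (ds (here refl))

  module _ {X} (wl : WellLabelled X) where

    new-at : ∀ {i C K} → (i , C) ∈ X → K ∈ below C → (i , K) ∉ X → New X (i , K)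
    new-at m k fresh = let (i∈ , C∈) , ii = wl m in
      fresh , (i∈ , subs-closed A₀ C∈ k) , there ii

    expand-box : ∀ {i C A} → (i , C) ∈ X → A ∈ below C →
      ((∀ {K} → (A , K) ∉ X) → Provable ((A , A) ∷ X) → Provable X) → (A , A) ∈ X ⊎ Expansion X
    expand-box {A = A} m k r with (A , A) ∈? X
    ... | yes p = inj₁ p
    ... | no ¬p = let A∈ = subs-closed A₀ (proj₂ (proj₁ (wl m))) k in
      inj₂ (expand₁ (¬p , (A∈ , A∈) , here refl) (r (λ n → ¬p (proj₂ (wl n)))))

    expand-dia : ∀ {i C A} → (i , C) ∈ X → A ∈ below C →
      (∀ {j} → Provable ((j , A) ∷ X) → Provable X) →
      (∀ {j} → j ∈ map proj₁ X → (j , A) ∈ X) ⊎ Expansion X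
    expand-dia {A = A} m k r = traverse (map proj₁ X) λ {j} n → try j n
      where
      try : ∀ j → j ∈ map proj₁ X → (j , A) ∈ X ⊎ Expansion X
      try j n with (j , A) ∈? X | ∈-map⁻ proj₁ n
      ... | yes p | _ = inj₁ p
      ... | no ¬p | _ , n′ , refl = let (j∈ , _) , jj = wl n′ in
        inj₂ (expand₁ (¬p , (j∈ , subs-closed A₀ (proj₂ (proj₁ (wl m))) k) , there jj) r)

    expand : ∀ {f} → f ∈ X → Saturated X f ⊎ Expansion X
    expand {i , at a} m with (i , na a) ∈? X
    ... | yes n = inj₂ ([] , (λ ()) , λ _ → provable-clash m n)
    ... | no ¬n = inj₁ ¬n
    expand {i , na a} m = inj₁ tt
    expand {i , A ∨ C} m with (i , A) ∈? X | (i , C) ∈? X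
    ... | yes p | yes q = inj₁ (p , q)
    ... | no ¬p | _     = inj₂ (expand₁ (new-at m (here refl) ¬p) (provable-∨ m (inj₁ refl)))
    ... | _     | no ¬q =
      inj₂ (expand₁ (new-at m (∈-++⁺ʳ (subs A) (here refl)) ¬q) (provable-∨ m (inj₂ refl)))
    expand {i , A ∧ C} m with (i , A) ∈? X | (i , C) ∈? X
    ... | yes p | _     = inj₁ (inj₁ p)
    ... | _     | yes q = inj₁ (inj₂ q)
    ... | no ¬p | no ¬q = inj₂ ((i , A) ∷ (i , C) ∷ []
      , (λ { (here refl)         → new-at m (here refl) ¬p
           ; (there (here refl)) → new-at m (∈-++⁺ʳ (subs A) (here refl)) ¬q })
      , λ ds → provable-∧ m (ds (here refl)) (ds (there (here refl))))
    expand {i , □ A} m = expand-box m (here refl) (provable-□ m)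
    expand {i , ■ A} m = expand-box m (here refl) (provable-■ m)
    expand {i , ◇ A} m = expand-dia m (here refl) (provable-◇ A m)
    expand {i , ◆ A} m = expand-dia m (here refl) (provable-◆ A m)

  remove : ∀ {f : Fact} {R n} → f ∈ R → length R ≡ suc n →
           ∃[ R′ ] length R′ ≡ n × (∀ {g} → g ∈ R → g ≡ f ⊎ g ∈ R′)
  remove {R = _ ∷ R} (here refl) refl = R , refl , λ { (here e) → inj₁ e ; (there m) → inj₂ m }
  remove {R = g ∷ _ ∷ _} (there m) refl =
    let R′ , e , k = remove m refl in
    g ∷ R′ , cong suc e , λ { (here e) → inj₂ (here e) ; (there n) → map₂ there (k n) }

  empty : ∀ {R : List Fact} → length R ≡ 0 → ∀ {f} → f ∉ R
  empty {[]} _ ()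

  Result : List Fact → Set
  Result X = Provable X ⊎ ∃[ Y ] X ⊆ Y × (∀ {f} → f ∈ Y → Saturated Y f)

  -- R lists the facts not yet in X; every expansion moves one of them to X.
  search : ∀ n X R → length R ≡ n → WellLabelled X → (∀ {f} → InRange f → f ∈ X ⊎ f ∈ R) → Result X
  search n X R len wl cov with traverse X (expand wl)
  ... | inj₁ sat = inj₂ (X , (λ m → m) , sat)
  ... | inj₂ (fs , new , rule) = map₁ rule (traverse fs (λ m → branch n len (new m)))
    where
    wl′ : ∀ {f} → New X f → WellLabelled (f ∷ X)
    wl′ (_ , r , ii) (here refl) = r , ii
    wl′ _            (there m)   = let r , ii = wl m in r , there ii

    branch : ∀ {f} n → length R ≡ n → New X f →
             Provable (f ∷ X) ⊎ ∃[ Y ] X ⊆ Y × (∀ {f} → f ∈ Y → Saturated Y f)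
    branch n len ν@(fresh , r , _) with cov r
    ... | inj₁ m = contradiction m fresh
    branch zero    len ν | inj₂ m = contradiction m (empty len)
    branch (suc n) len ν | inj₂ m with remove m len
    ... | R′ , len′ , k with search n _ R′ len′ (wl′ ν) (λ r → cov′ (cov r))
      where
      cov′ : ∀ {g} → g ∈ X ⊎ g ∈ R → g ∈ _ ∷ X ⊎ g ∈ R′
      cov′ (inj₁ m) = inj₁ (there m)
      cov′ (inj₂ m) with k m
      ... | inj₁ e = inj₁ (here e)
      ... | inj₂ m = inj₂ m
    ... | inj₁ d = inj₁ d
    ... | inj₂ (Y , X⊆Y , sat) = inj₂ (Y , (λ m → X⊆Y (there m)) , sat)

  decide : Result [ (A₀ , A₀) ]
  decide = search _ _ (cartesianProduct (subs A₀) (subs A₀)) refl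
    (λ { (here refl) → (here refl , here refl) , here refl })
    (λ (i∈ , A∈) → inj₂ (∈-cartesianProduct⁺ i∈ A∈))

-- Countermodels, translation into formulae, and completeness

module Truth {Y : List Fact} (sat : ∀ {f} → f ∈ Y → Saturated Y f) where
  open Model (map proj₁ Y) (λ i a → does ((i , na a) ∈? Y)) public

  truth : ∀ A {i} → (i , A) ∈ Y → Fails A i
  truth (at a)  m = dec-false (_ ∈? Y) (sat m)
  truth (na a)  m = dec-true (_ ∈? Y) m
  truth (A ∨ C) m = let p , q = sat m in truth A p , truth C q
  truth (A ∧ C) m = ⊎-map (truth A) (truth C) (sat m)
  truth (□ A)   m = A , ∈-map⁺ proj₁ (sat m) , truth A (sat m)
  truth (■ A)   m = A , ∈-map⁺ proj₁ (sat m) , truth A (sat m)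
  truth (◇ A)   m = λ n → truth A (sat m n)
  truth (◆ A)   m = λ n → truth A (sat m n)

-- nothing translates the empty disjunction. Both kinds of structure become □.
_∨?_ : Maybe Fm → Maybe Fm → Maybe Fm
just A  ∨? just C  = just (A ∨ C)
just A  ∨? nothing = just A
nothing ∨? m       = m

mutual
  ⌜_⌝ᴵ : Item → Maybe Fm
  ⌜ fm A ⌝ᴵ = just A
  ⌜ wh Δ ⌝ᴵ = Maybe.map □ ⌜ Δ ⌝
  ⌜ bl Δ ⌝ᴵ = Maybe.map □ ⌜ Δ ⌝

  ⌜_⌝ : Seq → Maybe Fm
  ⌜ [] ⌝    = nothing
  ⌜ x ∷ Γ ⌝ = ⌜ x ⌝ᴵ ∨? ⌜ Γ ⌝

∷-⊑ : ∀ x Γ → Γ ⊑ (x ∷ Γ)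
∷-⊑ x Γ = graft-⊑ root [ x ]

inW-⊑ : ∀ Δ Γ → Δ ⊑ (wh Δ ∷ Γ)
inW-⊑ Δ Γ = record { move = sub ∘ inW ; keeps = λ p m → m }

inB-⊑ : ∀ Δ Γ → Δ ⊑ (bl Δ ∷ Γ)
inB-⊑ Δ Γ = record { move = sub ∘ inB ; keeps = λ p m → m }

-- The witness for the box translating a structure, white or black, is the root node of that
-- structure.
has-⌜⌝ : ∀ Γ → AllM (Has {Γ} root) ⌜ Γ ⌝
has-⌜⌝ [] = nothing
has-⌜⌝ (x ∷ Γ) = join (head x) (lift (has-⌜⌝ Γ))
  where
  join : ∀ {M N} → AllM (Has {x ∷ Γ} root) M → AllM (Has {x ∷ Γ} root) N →
         AllM (Has {x ∷ Γ} root) (M ∨? N)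
  join (just h) (just k) = just (or h k)
  join (just h) nothing  = just h
  join nothing  k        = k

  lift : ∀ {M} → AllM (Has {Γ} root) M → AllM (Has {x ∷ Γ} root) M
  lift (just h) = just (Has-move (∷-⊑ x Γ) h)
  lift nothing  = nothing

  head : ∀ x → AllM (Has {x ∷ Γ} root) ⌜ x ⌝ᴵ
  head (fm A) = just (real (here refl))
  head (wh Δ) with ⌜ Δ ⌝ | has-⌜⌝ Δ
  ... | _ | just h  = just (box _ (Has-move (inW-⊑ Δ Γ) h))
  ... | _ | nothing = nothing
  head (bl Δ) with ⌜ Δ ⌝ | has-⌜⌝ Δ
  ... | _ | just h  = just (box _ (Has-move (inB-⊑ Δ Γ) h))
  ... | _ | nothing = nothing

module Interpret {W : Set} (ws : List W) (val : W → ℕ → Bool) {w₀} (w₀∈ : w₀ ∈ ws) where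
  open Model ws val

  mutual
    failsI : ∀ x {w} → AllM (λ A → Fails A w) ⌜ x ⌝ᴵ → FailsI x w
    failsI (fm A) (just f) = f
    failsI (wh Δ) f = failsW Δ f
    failsI (bl Δ) f = failsW Δ f

    failsW : ∀ Δ {w} → AllM (λ A → Fails A w) (Maybe.map □ ⌜ Δ ⌝) → ∃[ v ] v ∈ ws × FailsS Δ v
    failsW Δ f with ⌜ Δ ⌝ | fails Δ
    failsW Δ (just (v , m , f)) | just A  | ih = v , m , ih (just f)
    -- A structure without formulae still needs a world to fail at; w₀ provides it.
    failsW Δ _                  | nothing | ih = _ , w₀∈ , ih nothing

    fails : ∀ Γ {w} → AllM (λ A → Fails A w) ⌜ Γ ⌝ → FailsS Γ w
    fails [] _ = tt
    fails (x ∷ Γ) f = let g , h = split ⌜ x ⌝ᴵ ⌜ Γ ⌝ f in failsI x g , fails Γ h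

    split : ∀ M N {w} → AllM (λ A → Fails A w) (M ∨? N) →
            AllM (λ A → Fails A w) M × AllM (λ A → Fails A w) N
    split (just A) (just C) (just (f , g)) = just f , just g
    split (just A) nothing  f              = f , nothing
    split nothing  N        f              = nothing , f

Refutes : Maybe Fm → Seq → Set₁
Refutes M Γ = ∀ {W : Set} (ws : List W) val {w₀ w} → w₀ ∈ ws →
              AllM (λ A → Model.Fails ws val A w) M → Model.FailsS ws val Γ w

-- The translation is generalised to M, so that matching on M leaves Γ alone.
complete : ∀ {Γ M} → AllM (Has {Γ} root) M → Refutes M Γ → SS5 Γ → DS5 Γ
-- With no formula to search for, the one-point model already contradicts soundness, whatever its
-- valuation.
complete nothing refutes d =
  contradiction (refutes ws val (here refl) nothing) (Model.sound ws val (here refl) d)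
  where
  ws  = [ tt ]
  val = λ _ _ → false
complete {M = just A} (just h) refutes d with Search.decide A
-- The only initial fact is A at the world named A, so every label may be sent to the root.
... | inj₁ p = p (λ _ → root) λ { (here refl) → h }
... | inj₂ (Y , X⊆Y , sat) =
  contradiction (refutes _ _ A∈ (just (truth A (X⊆Y (here refl))))) (sound A∈ d)
  where
  open Truth sat
  A∈ : A ∈ map proj₁ Y
  A∈ = ∈-map⁺ proj₁ (X⊆Y (here refl))

SS5⇒DS5 : ∀ {Γ} → SS5 Γ → DS5 Γ
SS5⇒DS5 {Γ} = complete (has-⌜⌝ Γ) λ ws val m → Interpret.fails ws val m Γ

theorem5p10 : (Γ : Seq) → (SS5 Γ → DS5 Γ) × (DS5 Γ → SS5 Γ)
theorem5p10 Γ = SS5⇒DS5 , DS5⇒SS5
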